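{- Let $n$ be a positive integer. The $q\times p$ matrix $R_n(z)=(R_{i,j,n}(z))_{0\leq i\leq q-1,\,0\leq j\leq p-1}$ has the expansion $$R_{n}(z)=(\tau_{\rho,0}\circ\tau_{\rho,1}\circ\cdots\circ\tau_{\rho,n-1})(X_{n}(z)),$$ where $X_n(z)$ is the $q\times p$ matrix with entries on the main diagonal equal to $1/z$, and zero entries elsewhere. More graphically, $$R_n(z)=\cfrac{\mathbf{1}}{\rho_{0}(z)+\rho_{0}^{+}\cfrac{\mathbf{1}}{\rho_{1}(z)+\rho_{1}^{+}\cfrac{\mathbf{1}}{\ddots\rho_{n-2}(z)+\rho_{n-2}^{+}\cfrac{\mathbf{1}}{\rho_{n-1}(z)+\rho_{n-1}^{+}X_{n}(z)\rho_{n-1}^{ - }}\,\rho_{n-2}^{ - }}\,\rho_{1}^{ - }}\,\rho_{0}^{ - }}.$$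
   Context: Fix integers $p,q\geq 1$ and, for each $-p\leq k\leq q$, a bi-infinite sequence $(a^{(k)}_{n})_{n\in\mathbb{Z}}$ of complex numbers. Let $H_n=(h_{i,j})_{i,j=0}^{n-1}$ be the $n\times n$ matrix with $h_{i,j}=a^{(j-i)}_{\min(i,j)}$ if $-p\leq j-i\leq q$ and $h_{i,j}=0$ otherwise. For $0\leq i,j\leq n-1$, $R_{i,j,n}(z)$ is the $(i,j)$-entry of $(zI_n-H_n)^{ -1}$ (a rational function, equivalently the series $\sum_{\ell\geq 0}(H_n^\ell)_{i,j}z^{ -\ell-1}$). If $n<\max(p,q)$, the matrix $R_n(z)$ also involves indices with $i\geq n$ or $j\geq n$; for these, $R_{i,j,n}(z)$ is understood as the $(i,j)$-entry of $(zI-\widetilde H)^{ -1}$, where $\widetilde H=(\widetilde h_{i,j})_{i,j=0}^{\infty}$ is the infinite matrix whose principal $n\times n$ truncation is $H_n$ and whose other entries are all zero; that is, $R_{i,j,n}(z)=1/z$ if $i=j\geq n$, and $R_{i,j,n}(z)=0$ if $i\neq j$ and $\max(i,j)\geq n$. (For $0\leq i,j\leq n-1$ the $(i,j)$-entry of $(zI-\widetilde H)^{ -1}$ is the one already defined.) Pseudo-quotient. For a $q\times p$ matrix $A=(a_{i,j})_{0\leq i\leq q-1,\,0\leq j\leq p-1}$ over a field (here the field $\mathbb{C}((z^{ -1}))$ of formal Laurent series with finitely many positive powers of $z$, which contains the rational functions) with $a_{0,0}\neq 0$, let $T(A)=B=(b_{i,j})$ be the $q\times p$ matrix with $$b_{i,j}=\frac{a_{i+1,j+1}a_{0,0}-a_{0,j+1}a_{i+1,0}}{a_{0,0}}\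 (0\leq i\leq q-2,\ 0\leq j\leq p-2),\quad b_{q-1,j}=-\frac{a_{0,j+1}}{a_{0,0}}\ (0\leq j\leq p-2),$$ $$b_{i,p-1}=\frac{a_{i+1,0}}{a_{0,0}}\ (0\leq i\leq q-2),\qquad b_{q-1,p-1}=\frac{1}{a_{0,0}}.$$ $T$ is a bijection from matrices with $a_{0,0}\neq 0$ onto matrices with $b_{q-1,p-1}\neq 0$; write $A=\frac{\mathbf 1}{B}$ if $B=T(A)$. Coefficients. For $0\leq k\leq n-1$: $\rho_k(z)$ is the $q\times p$ matrix whose only nonzero entry is $z-a_k^{(0)}$ in the bottom right corner. $\rho_k^+$ is the $q\times q$ matrix equal to the identity except that its last row is $(-b_k^{(1)},\ldots,-b_k^{(q)})$, where for $0\leq k\leq n-q-1$ one sets $b_k^{(i)}=a_k^{(i)}$ for $1\leq i\leq q$, and for $n-q\leq k\leq n-1$ one sets $b_k^{(i)}=a_k^{(i)}$ for $1\leq i\leq n-k-1$ and $b_k^{(i)}=0$ for $n-k\leq i\leq q$. $\rho_k^-$ is the $p\times p$ matrix equal to the identity except that its last column is $(b_k^{(-1)},\ldots,b_k^{(-p)})^t$, where for $0\leq k\leq n-p-1$ one sets $b_k^{(-j)}=a_k^{(-j)}$ for $1\leq j\leq p$, and for $n-p\leq k\leq n-1$ one sets $b_k^{(-j)}=a_k^{(-j)}$ for $1\leq j\leq n-k-1$ and $b_k^{(-j)}=0$ for $n-k\leq j\leq p$. For $q\times p$ matrices $X$, $$\tau_{\rho,k}(X)=\frac{\mathbf 1}{\rho_k(z)+\rho_k^+X\rho_k^-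 },\qquad 0\leq k\leq n-1.$$ -}

module Defs where

open import Algebra.Apartness.Bundles using (HeytingCommutativeRing; HeytingField)
open import Algebra.Bundles using (CommutativeRing)
open import Algebra.Bundles.Raw using (RawRing)
import Algebra.Definitions
import Algebra.Definitions.RawMonoid
import Algebra.Properties.Ring
import Algebra.Properties.Semiring.Sum
open import Data.Bool.Base using (Bool; if_then_else_; _∧_; true; false)
open import Data.Fin.Base using (Fin; zero; suc; toℕ; fromℕ; fromℕ<; inject₁)
open import Data.Fin.Relation.Unary.Top using (view; ‵fromℕ; ‵inject₁)
open import Data.Integer.Base as ℤ using (ℤ; +_; -[1+_]; ∣_∣)
import Data.Integer.Properties as ℤ
open import Data.Integer.Solver using (module +-*-Solver)
open import Data.Nat.Base as ℕ using (ℕ; zero; suc; _⊓_; _⊔_; _∸_)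
import Data.Nat.Properties as ℕ
open import Data.Product.Base using (_×_; _,_; proj₁; Σ-syntax)
open import Data.Vec.Functional using (Vector; updateAt)
open import Level using (Lift) renaming (_⊔_ to _⊔ˡ_)
open import Relation.Binary.PropositionalEquality.Core as ≡ using (_≡_)
import Relation.Binary.Reasoning.Setoid
open import Relation.Nullary.Decidable.Core using (does; yes; no)

Matrix : ∀ {c} → Set c → ℕ → ℕ → Set c
Matrix A m n = Fin m → Fin n → A

module MatrixAlgebra {c ℓ} (F : RawRing c ℓ) where
  open RawRing F
  open Algebra.Definitions.RawMonoid +-rawMonoid using (sum)

  infix  4 _≈ᴹ_ _≈𝟏/_
  infixl 6 _+ᴹ_ _-ᴹ_
  infixl 7 _*ᴹ_
  infixr 8 _^ᴹ_

  _≈ᴹ_ : ∀ {m n} → Matrix Carrier m n → Matrix Carrier m n → Set ℓ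
  A ≈ᴹ B = ∀ i j → A i j ≈ B i j

  scalar : ∀ {m n} → Carrier → Matrix Carrier m n
  scalar x i j = if does (toℕ i ℕ.≟ toℕ j) then x else 0#

  1ᴹ : ∀ {n} → Matrix Carrier n n
  1ᴹ = scalar 1#

  _+ᴹ_ _-ᴹ_ : ∀ {m n} → Matrix Carrier m n → Matrix Carrier m n → Matrix Carrier m n
  (A +ᴹ B) i j = A i j + B i j
  (A -ᴹ B) i j = A i j + - B i j

  _*ᴹ_ : ∀ {l m n} → Matrix Carrier l m → Matrix Carrier m n → Matrix Carrier l n
  (A *ᴹ B) i j = sum λ k → A i k * B k j

  _^ᴹ_ : ∀ {n} → Matrix Carrier n n → ℕ → Matrix Carrier n n
  A ^ᴹ zero  = 1ᴹ
  A ^ᴹ suc l = A *ᴹ A ^ᴹ l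

  Unit : Carrier → Set (c ⊔ˡ ℓ)
  Unit = Algebra.Definitions.Invertible _≈_ 1# _*_

  Unitᴹ : ∀ {n} → Matrix Carrier n n → Set (c ⊔ˡ ℓ)
  Unitᴹ = Algebra.Definitions.Invertible _≈ᴹ_ 1ᴹ _*ᴹ_

  -- The block matrix  ( body  col    )
  --                   ( row   corner ).
  bordered : ∀ {m n} → Matrix Carrier m n → Vector Carrier n → Vector Carrier m → Carrier →
             Matrix Carrier (suc m) (suc n)
  bordered body row col corner i j with view i | view j
  ... | ‵inject₁ i′ | ‵inject₁ j′ = body i′ j′
  ... | ‵fromℕ      | ‵inject₁ j′ = row j′
  ... | ‵inject₁ i′ | ‵fromℕ      = col i′
  ... | ‵fromℕ      | ‵fromℕ      = corner

  -- The pseudo-quotient map.  Over a field, a₀₀ ≠ 0 is read constructively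
  -- as invertibility of a₀₀ and division by a₀₀ as multiplication by its inverse.
  T : ∀ {m n} (A : Matrix Carrier (suc m) (suc n)) → Unit (A zero zero) →
      Matrix Carrier (suc m) (suc n)
  T A (a₀₀⁻¹ , _) = bordered
    (λ i j → (A (suc i) (suc j) * A zero zero + - (A zero (suc j) * A (suc i) zero)) * a₀₀⁻¹)
    (λ j → - (A zero (suc j) * a₀₀⁻¹))
    (λ i → A (suc i) zero * a₀₀⁻¹)
    a₀₀⁻¹

  -- A ≈𝟏/ B  is the relation  A = 𝟏/B.  As T is injective, it determines A
  -- from B; it is the graph of a partial function, since 𝟏/B exists only when
  -- the bottom right entry of B is nonzero.
  _≈𝟏/_ : ∀ {m n} → Matrix Carrier (suc m) (suc n) → Matrix Carrier (suc m) (suc n) → Set (c ⊔ˡ ℓ)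
  A ≈𝟏/ B = Σ[ a₀₀-unit ∈ Unit (A zero zero) ] T A a₀₀-unit ≈ᴹ B

module LaurentSeries {c ℓ} (F : RawRing c ℓ) where
  open RawRing F
  open Algebra.Definitions.RawMonoid +-rawMonoid using (sum)

  -- The formal series  Σ_{i ≥ 0} digit i · z^(top - i).  Leading digits may
  -- vanish, so a series has many representations; they are identified by ≈ᴸ.
  record Laurent : Set c where
    constructor laurent
    field
      top   : ℕ
      digit : ℕ → Carrier
  open Laurent public

  digitℤ : (ℕ → Carrier) → ℤ → Carrier
  digitℤ d (+ i)    = d i
  digitℤ d -[1+ _ ] = 0#

  -- The coefficient of z^m.
  coeff : Laurent → ℤ → Carrier
  coeff f m = digitℤ (digit f) (+ top f ℤ.- m)

  infix 4 _≈ᴸ_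
  _≈ᴸ_ : Laurent → Laurent → Set ℓ
  f ≈ᴸ g = ∀ m → coeff f m ≈ coeff g m

  _+ᴸ_ _*ᴸ_ : Laurent → Laurent → Laurent
  f +ᴸ g = laurent t λ i → coeff f (+ t ℤ.- + i) + coeff g (+ t ℤ.- + i)
    where t = top f ⊔ top g
  f *ᴸ g = laurent (top f ℕ.+ top g) λ i →
    sum {suc i} λ k → digit f (toℕ k) * digit g (i ∸ toℕ k)

  -ᴸ_ : Laurent → Laurent
  -ᴸ f = laurent (top f) λ i → - digit f i

  _at_ : Carrier → ℕ → ℕ → Carrier
  (x at i) j = if does (i ℕ.≟ j) then x else 0#

  constant : Carrier → Laurent
  constant x = laurent 0 (x at 0)

  z z⁻¹ : Laurent
  z   = laurent 1 (1# at 0)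
  z⁻¹ = laurent 0 (1# at 1)

  rawRing : RawRing c ℓ
  rawRing = record
    { Carrier = Laurent ; _≈_ = _≈ᴸ_ ; _+_ = _+ᴸ_ ; _*_ = _*ᴸ_ ; -_ = -ᴸ_
    ; 0# = constant 0# ; 1# = constant 1# }

module Resolvent {c ℓ} (F : CommutativeRing c ℓ) where
  open CommutativeRing F hiding (zero)
  open LaurentSeries rawRing renaming (rawRing to laurentRing)
  private
    module K = MatrixAlgebra rawRing
    module L = MatrixAlgebra laurentRing

  zI-_ : ∀ {n} → Matrix Carrier n n → Matrix Laurent n n
  zI- A = L.scalar z L.-ᴹ (λ i j → constant (A i j))

  neumannDigit : ∀ {n} → Matrix Carrier n n → Fin n → Fin n → ℕ → Carrier
  neumannDigit A i j zero    = 0#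
  neumannDigit A i j (suc l) = (A K.^ᴹ l) i j

  -- Σ_{l ≥ 0} A^l z^(-l-1)
  neumann : ∀ {n} → Matrix Carrier n n → Matrix Laurent n n
  neumann A i j = laurent 0 (neumannDigit A i j)

  private
    open Algebra.Properties.Semiring.Sum semiring
      using (sum; sum-cong-≋; sum-replicate-zero; ∑-distrib-+; ∑-comm;
             *-distribˡ-sum; *-distribʳ-sum)
    open Algebra.Definitions.RawMonoid (RawRing.+-rawMonoid laurentRing) using ()
      renaming (sum to sumᴸ)
    open Algebra.Properties.Ring ring using (-‿distribˡ-*; -0#≈0#)
    open Relation.Binary.Reasoning.Setoid setoid

    δ : Bool → Carrier
    δ b = if b then 1# else 0#

    sum-zero : ∀ {n} (f : Vector Carrier n) → (∀ k → f k ≈ 0#) → sum f ≈ 0#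
    sum-zero {n} f f≈0 = trans (sum-cong-≋ f≈0) (sum-replicate-zero n)

    sum-δˡ : ∀ {n} (i : Fin n) (f : Vector Carrier n) →
             sum (λ k → K.1ᴹ i k * f k) ≈ f i
    sum-δˡ {suc n} zero f = begin
      1# * f zero + _  ≈⟨ +-cong (*-identityˡ _) (sum-zero {n} (λ k → 0# * f (suc k)) λ k → zeroˡ _) ⟩
      f zero + 0#      ≈⟨ +-identityʳ _ ⟩
      f zero           ∎
    sum-δˡ (suc i) f = begin
      0# * f zero + _  ≈⟨ +-cong (zeroˡ _) (sum-δˡ i (λ k → f (suc k))) ⟩
      0# + f (suc i)   ≈⟨ +-identityˡ _ ⟩
      f (suc i)        ∎

    sum-δʳ : ∀ {n} (j : Fin n) (f : Vector Carrier n) →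
             sum (λ k → K.1ᴹ k j * f k) ≈ f j
    sum-δʳ {suc n} zero f = begin
      1# * f zero + _  ≈⟨ +-cong (*-identityˡ _) (sum-zero {n} (λ k → 0# * f (suc k)) λ k → zeroˡ _) ⟩
      f zero + 0#      ≈⟨ +-identityʳ _ ⟩
      f zero           ∎
    sum-δʳ (suc j) f = begin
      0# * f zero + _  ≈⟨ +-cong (zeroˡ _) (sum-δʳ j (λ k → f (suc k))) ⟩
      0# + f (suc j)   ≈⟨ +-identityˡ _ ⟩
      f (suc j)        ∎

    *ᴹ-assoc : ∀ {n} (A B C : Matrix Carrier n n) → (A K.*ᴹ B) K.*ᴹ C K.≈ᴹ A K.*ᴹ (B K.*ᴹ C)
    *ᴹ-assoc A B C i j = begin
      sum (λ k → sum (λ l → A i l * B l k) * C k j)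
        ≈⟨ sum-cong-≋ (λ k → *-distribʳ-sum (C k j) (λ l → A i l * B l k)) ⟩
      sum (λ k → sum (λ l → A i l * B l k * C k j))
        ≈⟨ ∑-comm (λ k l → A i l * B l k * C k j) ⟩
      sum (λ l → sum (λ k → A i l * B l k * C k j))
        ≈⟨ sum-cong-≋ (λ l → sum-cong-≋ λ k → *-assoc (A i l) (B l k) (C k j)) ⟩
      sum (λ l → sum (λ k → A i l * (B l k * C k j)))
        ≈⟨ sum-cong-≋ (λ l → *-distribˡ-sum (A i l) (λ k → B l k * C k j)) ⟨
      sum (λ l → A i l * sum (λ k → B l k * C k j)) ∎

    ^ᴹ-comm : ∀ {n} (A : Matrix Carrier n n) l → (A K.^ᴹ l) K.*ᴹ A K.≈ᴹ A K.^ᴹ suc l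
    ^ᴹ-comm A zero i j = begin
      sum (λ k → K.1ᴹ i k * A k j)  ≈⟨ sum-δˡ i (λ k → A k j) ⟩
      A i j                         ≈⟨ sum-δʳ j (A i) ⟨
      sum (λ k → K.1ᴹ k j * A i k)  ≈⟨ sum-cong-≋ (λ k → *-comm (K.1ᴹ k j) (A i k)) ⟩
      sum (λ k → A i k * K.1ᴹ k j)  ∎
    ^ᴹ-comm A (suc l) i j =
      trans (*ᴹ-assoc A (A K.^ᴹ l) A i j)
            (sum-cong-≋ λ k → *-congˡ (^ᴹ-comm A l k j))

    digitℤ-neg : ∀ d {k} → k ℤ.< + 0 → digitℤ d k ≡ 0#
    digitℤ-neg d ℤ.-<+       = ≡.refl
    digitℤ-neg d (ℤ.+<+ ())

    coeff-above : ∀ f {t m} → top f ℕ.≤ t → + t ℤ.- m ℤ.< + 0 → coeff f m ≡ 0#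
    coeff-above f {t} {m} f≤t t<m = digitℤ-neg (digit f)
      (ℤ.≤-<-trans (ℤ.+-monoˡ-≤ (ℤ.- m) (ℤ.+≤+ f≤t)) t<m)

    x-y≡z⇒x-z≡y : ∀ x y z → x ℤ.- y ≡ z → x ℤ.- z ≡ y
    x-y≡z⇒x-z≡y x y _ ≡.refl =
      solve 2 (λ x y → x :- (x :- y) := y) ≡.refl x y
      where open +-*-Solver

    coeff-+ : ∀ f g m → coeff (f +ᴸ g) m ≈ coeff f m + coeff g m
    coeff-+ f g m = go _ ≡.refl
      where
      t = top f ⊔ top g
      go : ∀ y → + t ℤ.- m ≡ y → digitℤ (digit (f +ᴸ g)) y ≈ coeff f m + coeff g m
      go (+ i) eq = reflexive (≡.cong (λ k → coeff f k + coeff g k) (x-y≡z⇒x-z≡y (+ t) m (+ i) eq))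
      go -[1+ i ] eq = sym (trans
        (+-cong (reflexive (coeff-above f {m = m} (ℕ.m≤m⊔n (top f) (top g)) neg))
                (reflexive (coeff-above g {m = m} (ℕ.m≤n⊔m (top f) (top g)) neg)))
        (+-identityˡ 0#))
        where
        neg : + t ℤ.- m ℤ.< + 0
        neg = ≡.subst (ℤ._< + 0) (≡.sym eq) ℤ.-<+

    digitℤ-0at : ∀ i y → digitℤ (0# at i) y ≡ 0#
    digitℤ-0at i -[1+ _ ] = ≡.refl
    digitℤ-0at i (+ j) with does (i ℕ.≟ j)
    ... | true  = ≡.refl
    ... | false = ≡.refl

    coeff-sum : ∀ {n} (f : Vector Laurent n) m →
                coeff (sumᴸ f) m ≈ sum (λ k → coeff (f k) m)
    coeff-sum {zero}  f m = reflexive (digitℤ-0at 0 (+ 0 ℤ.- m))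
    coeff-sum {suc n} f m =
      trans (coeff-+ (f zero) _ m) (+-congˡ (coeff-sum (λ k → f (suc k)) m))

    conv : (ℕ → Carrier) → (ℕ → Carrier) → ℕ → Carrier
    conv c d i = sum {suc i} λ k → c (toℕ k) * d (i ∸ toℕ k)

    conv-last : ∀ c d i → conv c d (suc i) ≈ conv c (λ j → d (suc j)) i + c (suc i) * d 0
    conv-last c d zero    = begin
      c 0 * d 1 + (c 1 * d 0 + 0#)  ≈⟨ +-assoc _ _ _ ⟨
      c 0 * d 1 + c 1 * d 0 + 0#    ≈⟨ +-identityʳ _ ⟩
      c 0 * d 1 + c 1 * d 0         ≈⟨ +-congʳ (+-identityʳ _) ⟨
      c 0 * d 1 + 0# + c 1 * d 0    ∎
    conv-last c d (suc i) =
      trans (+-congˡ (conv-last (λ j → c (suc j)) d i)) (sym (+-assoc _ _ _))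

    conv-comm : ∀ c d i → conv c d i ≈ conv d c i
    conv-comm c d zero    = +-congʳ (*-comm _ _)
    conv-comm c d (suc i) = begin
      c 0 * d (suc i) + conv (λ j → c (suc j)) d i
        ≈⟨ +-cong (*-comm _ _) (conv-comm (λ j → c (suc j)) d i) ⟩
      d (suc i) * c 0 + conv d (λ j → c (suc j)) i
        ≈⟨ +-comm _ _ ⟩
      conv d (λ j → c (suc j)) i + d (suc i) * c 0
        ≈⟨ conv-last d c i ⟨
      conv d c (suc i) ∎

    digitℤ-conv-comm : ∀ c d y → digitℤ (conv c d) y ≈ digitℤ (conv d c) y
    digitℤ-conv-comm c d (+ i)    = conv-comm c d i
    digitℤ-conv-comm c d -[1+ _ ] = refl

    conv-linear : ∀ {u v} c d → c 0 ≈ u → c 1 ≈ v → (∀ j → c (suc (suc j)) ≈ 0#) → ∀ y →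
                  digitℤ (conv c d) y ≈ u * digitℤ d y + v * digitℤ d (ℤ.pred y)
    conv-linear c d c₀ c₁ c₂ -[1+ _ ] =
      sym (trans (+-cong (zeroʳ _) (zeroʳ _)) (+-identityˡ 0#))
    conv-linear c d c₀ c₁ c₂ (+ zero) = +-cong (*-congʳ c₀) (sym (zeroʳ _))
    conv-linear c d c₀ c₁ c₂ (+ suc i) = +-cong (*-congʳ c₀)
      (trans (+-cong (*-congʳ c₁)
                     (sum-zero {i} (λ k → c (suc (suc (toℕ k))) * d (i ∸ suc (toℕ k)))
                       λ k → trans (*-congʳ (c₂ (toℕ k))) (zeroˡ _)))
             (+-identityʳ _))

    conv-constant : ∀ {v} c d → c 0 ≈ v → (∀ j → c (suc j) ≈ 0#) → ∀ y →
                    digitℤ (conv c d) y ≈ v * digitℤ d y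
    conv-constant c d c₀ c₁ -[1+ _ ] = sym (zeroʳ _)
    conv-constant c d c₀ c₁ (+ i) =
      trans (+-cong (*-congʳ c₀)
                    (sum-zero {i} (λ k → c (suc (toℕ k)) * d (i ∸ suc (toℕ k)))
                       λ k → trans (*-congʳ (c₁ (toℕ k))) (zeroˡ _)))
            (+-identityʳ _)

    entry : Bool → Carrier → Laurent
    entry b x = (if b then z else constant 0#) +ᴸ (-ᴸ constant x)

    0+-0≈0 : 0# + - 0# ≈ 0#
    0+-0≈0 = trans (+-identityˡ _) -0#≈0#

    pred-lemma : ∀ m → + 0 ℤ.- m ≡ ℤ.pred (+ 1 ℤ.- m)
    pred-lemma m = ℤ.+-assoc -[1+ 0 ] (+ 1) (ℤ.- m)

    coeff-entry* : ∀ b x d m → coeff (entry b x *ᴸ laurent 0 d) m ≈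
      δ b * digitℤ d (+ 1 ℤ.- m) + - x * digitℤ d (ℤ.pred (+ 1 ℤ.- m))
    coeff-entry* true x d m =
      conv-linear (digit (entry true x)) d (+-identityʳ _) (+-identityˡ _) (λ _ → 0+-0≈0) (+ 1 ℤ.- m)
    coeff-entry* false x d m = begin
      digitℤ (conv (digit (entry false x)) d) (+ 0 ℤ.- m)
        ≈⟨ conv-constant (digit (entry false x)) d (+-identityˡ _) (λ _ → 0+-0≈0) (+ 0 ℤ.- m) ⟩
      - x * digitℤ d (+ 0 ℤ.- m)
        ≡⟨ ≡.cong (λ y → - x * digitℤ d y) (pred-lemma m) ⟩
      - x * digitℤ d (ℤ.pred (+ 1 ℤ.- m))
        ≈⟨ +-identityˡ _ ⟨
      0# + - x * digitℤ d (ℤ.pred (+ 1 ℤ.- m))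
        ≈⟨ +-congʳ (zeroˡ _) ⟨
      0# * digitℤ d (+ 1 ℤ.- m) + - x * digitℤ d (ℤ.pred (+ 1 ℤ.- m)) ∎

    coeff-*entry : ∀ b x d m → coeff (laurent 0 d *ᴸ entry b x) m ≈
      δ b * digitℤ d (+ 1 ℤ.- m) + - x * digitℤ d (ℤ.pred (+ 1 ℤ.- m))
    coeff-*entry true  x d m = trans
      (digitℤ-conv-comm d (digit (entry true x)) (+ 1 ℤ.- m)) (coeff-entry* true x d m)
    coeff-*entry false x d m = trans
      (digitℤ-conv-comm d (digit (entry false x)) (+ 0 ℤ.- m)) (coeff-entry* false x d m)

    coeff-1ᴹ : ∀ b m → coeff (if b then constant 1# else constant 0#) m
                       ≡ digitℤ (δ b at 0) (ℤ.pred (+ 1 ℤ.- m))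
    coeff-1ᴹ true  m = ≡.cong (digitℤ (1# at 0)) (pred-lemma m)
    coeff-1ᴹ false m = ≡.cong (digitℤ (0# at 0)) (pred-lemma m)

    x-0≈x : ∀ {x y} → y ≈ 0# → x + - y ≈ x
    x-0≈x y≈0 = trans (+-congˡ (trans (-‿cong y≈0) -0#≈0#)) (+-identityʳ _)

    sum-neg : ∀ {n} (f g : Vector Carrier n) →
              sum (λ k → - f k * g k) ≈ - sum (λ k → f k * g k)
    sum-neg f g = begin
      sum (λ k → - f k * g k)         ≈⟨ sum-cong-≋ (λ k → -‿distribˡ-* (f k) (g k)) ⟨
      sum (λ k → - (f k * g k))       ≈⟨ sum-‿- (λ k → f k * g k) ⟩
      - sum (λ k → f k * g k)         ∎
      where
      sum-‿- : ∀ {n} (f : Vector Carrier n) → sum (λ k → - f k) ≈ - sum f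
      sum-‿- {zero}  f = sym -0#≈0#
      sum-‿- {suc n} f = trans (+-congˡ (sum-‿- (λ k → f (suc k)))) (-‿+-comm _ _)
        where open Algebra.Properties.Ring ring using (-‿+-comm)

    telescope : ∀ {n} (A : Matrix Carrier n n) i j (S : ℕ → Vector Carrier n) (r : Vector Carrier n) →
      (∀ k → S 0 k ≈ 0#) → (∀ l → sum (λ k → r k * S (suc l) k) ≈ (A K.^ᴹ suc l) i j) → ∀ y →
      digitℤ (neumannDigit A i j) y + - sum (λ k → r k * digitℤ (λ l → S l k) (ℤ.pred y))
        ≈ digitℤ (K.1ᴹ i j at 0) (ℤ.pred y)
    telescope A i j S r S₀ S₊ -[1+ _ ]         = x-0≈x (sum-zero (λ k → r k * 0#) λ _ → zeroʳ _)
    telescope A i j S r S₀ S₊ (+ zero)         = x-0≈x (sum-zero (λ k → r k * 0#) λ _ → zeroʳ _)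
    telescope A i j S r S₀ S₊ (+ suc zero)     =
      x-0≈x (sum-zero (λ k → r k * S 0 k) λ k → trans (*-congˡ (S₀ k)) (zeroʳ _))
    telescope A i j S r S₀ S₊ (+ suc (suc l))  =
      trans (+-congˡ (-‿cong (S₊ l))) (-‿inverseʳ _)

  neumann-inverseʳ : ∀ {n} (A : Matrix Carrier n n) → (zI- A) L.*ᴹ neumann A L.≈ᴹ L.1ᴹ
  neumann-inverseʳ {n} A i j m = begin
    coeff (((zI- A) L.*ᴹ neumann A) i j) m
      ≈⟨ coeff-sum (λ k → (zI- A) i k *ᴸ neumann A k j) m ⟩
    sum (λ k → coeff ((zI- A) i k *ᴸ neumann A k j) m)
      ≈⟨ sum-cong-≋ (λ k → coeff-entry* _ (A i k) (N k j) m) ⟩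
    sum (λ k → K.1ᴹ i k * digitℤ (N k j) y + - A i k * digitℤ (N k j) (ℤ.pred y))
      ≈⟨ ∑-distrib-+ (λ k → K.1ᴹ i k * digitℤ (N k j) y) _ ⟩
    sum (λ k → K.1ᴹ i k * digitℤ (N k j) y) + sum (λ k → - A i k * digitℤ (N k j) (ℤ.pred y))
      ≈⟨ +-cong (sum-δˡ i _) (sum-neg (A i) _) ⟩
    digitℤ (N i j) y + - sum (λ k → A i k * digitℤ (N k j) (ℤ.pred y))
      ≈⟨ telescope A i j (λ l k → N k j l) (A i) (λ _ → refl) (λ _ → refl) y ⟩
    digitℤ (K.1ᴹ i j at 0) (ℤ.pred y)
      ≡⟨ coeff-1ᴹ (does (toℕ i ℕ.≟ toℕ j)) m ⟨
    coeff (L.1ᴹ i j) m ∎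
    where
    N = neumannDigit A
    y = + 1 ℤ.- m

  neumann-inverseˡ : ∀ {n} (A : Matrix Carrier n n) → neumann A L.*ᴹ (zI- A) L.≈ᴹ L.1ᴹ
  neumann-inverseˡ {n} A i j m = begin
    coeff ((neumann A L.*ᴹ (zI- A)) i j) m
      ≈⟨ coeff-sum (λ k → neumann A i k *ᴸ (zI- A) k j) m ⟩
    sum (λ k → coeff (neumann A i k *ᴸ (zI- A) k j) m)
      ≈⟨ sum-cong-≋ (λ k → coeff-*entry _ (A k j) (N i k) m) ⟩
    sum (λ k → K.1ᴹ k j * digitℤ (N i k) y + - A k j * digitℤ (N i k) (ℤ.pred y))
      ≈⟨ ∑-distrib-+ (λ k → K.1ᴹ k j * digitℤ (N i k) y) _ ⟩
    sum (λ k → K.1ᴹ k j * digitℤ (N i k) y) + sum (λ k → - A k j * digitℤ (N i k) (ℤ.pred y))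
      ≈⟨ +-cong (sum-δʳ j _) (sum-neg (λ k → A k j) _) ⟩
    digitℤ (N i j) y + - sum (λ k → A k j * digitℤ (N i k) (ℤ.pred y))
      ≈⟨ telescope A i j (λ l k → N i k l) (λ k → A k j) (λ _ → refl)
           (λ l → trans (sum-cong-≋ λ k → *-comm (A k j) _) (^ᴹ-comm A l i j)) y ⟩
    digitℤ (K.1ᴹ i j at 0) (ℤ.pred y)
      ≡⟨ coeff-1ᴹ (does (toℕ i ℕ.≟ toℕ j)) m ⟨
    coeff (L.1ᴹ i j) m ∎
    where
    N = neumannDigit A
    y = + 1 ℤ.- m

  zI-_-unit : ∀ {n} (A : Matrix Carrier n n) → L.Unitᴹ (zI- A)
  zI- A -unit = neumann A , neumann-inverseˡ A , neumann-inverseʳ A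

-- K is an arbitrary field, ℂ being the intended one;  p = suc p-1 and q = suc q-1.  The sequence a^(k) is  a k : ℤ → Carrier;
-- only the values of a k at -p ≤ k ≤ q are ever used.
module ContinuedFraction {c ℓ₁ ℓ₂} (K : HeytingField c ℓ₁ ℓ₂) (p-1 q-1 : ℕ)
                         (a : ℤ → ℤ → HeytingField.Carrier K) (n : ℕ) where
  open HeytingField K using (Carrier; 0#; -_; heytingCommutativeRing)
  open HeytingCommutativeRing heytingCommutativeRing using (commutativeRing)
  open LaurentSeries (CommutativeRing.rawRing commutativeRing) renaming (rawRing to laurentRing)
  open MatrixAlgebra laurentRing
  open Resolvent commutativeRing using (zI-_; zI-_-unit)

  p q : ℕ
  p = suc p-1
  q = suc q-1

  h : ℕ → ℕ → Carrier
  h i j = if does (ℤ.- + p ℤ.≤? + j ℤ.- + i) ∧ does (+ j ℤ.- + i ℤ.≤? + q)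
          then a (+ j ℤ.- + i) (+ (i ⊓ j))
          else 0#

  H : Matrix Carrier n n
  H i j = h (toℕ i) (toℕ j)

  [zI-H]⁻¹ : Matrix Laurent n n
  [zI-H]⁻¹ = proj₁ (zI- H -unit)

  Rᵢⱼ : ℕ → ℕ → Laurent
  Rᵢⱼ i j with i ℕ.<? n | j ℕ.<? n
  ... | yes i<n | yes j<n = [zI-H]⁻¹ (fromℕ< i<n) (fromℕ< j<n)
  ... | _       | _       = if does (i ℕ.≟ j) then z⁻¹ else constant 0#

  R : Matrix Laurent q p
  R i j = Rᵢⱼ (toℕ i) (toℕ j)

  X : Matrix Laurent q p
  X = scalar z⁻¹

  -- b_k^(s) for s = 1,…,q and s = -1,…,-p.  The condition |s| ≤ n - k - 1 is
  -- automatic when k ≤ n - q - 1 (resp. k ≤ n - p - 1).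
  b : ℕ → ℤ → Carrier
  b k s = if does (k ℕ.+ ∣ s ∣ ℕ.<? n) then a s (+ k) else 0#

  ρ : ℕ → Matrix Laurent q p
  ρ k = bordered (λ _ _ → 0ᴸ) (λ _ → 0ᴸ) (λ _ → 0ᴸ) (z +ᴸ (-ᴸ constant (a (+ 0) (+ k))))
    where 0ᴸ = constant 0#

  ρ⁺ : ℕ → Matrix Laurent q q
  ρ⁺ k = updateAt 1ᴹ (fromℕ q-1) λ _ j → -ᴸ constant (b k (+ suc (toℕ j)))

  ρ⁻ : ℕ → Matrix Laurent p p
  ρ⁻ k i = updateAt (1ᴹ i) (fromℕ p-1) λ _ → constant (b k (ℤ.- + suc (toℕ i)))

  -- Y ≈τ[ k ] X  is the relation  Y = τ_{ρ,k}(X).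
  _≈τ[_]_ : Matrix Laurent q p → ℕ → Matrix Laurent q p → Set (c ⊔ˡ ℓ₁)
  Y ≈τ[ k ] X = Y ≈𝟏/ (ρ k +ᴹ ρ⁺ k *ᴹ X *ᴹ ρ⁻ k)

  -- Y ≈τ[ k ⋯+ m ] X  is the relation  Y = (τ_{ρ,k} ∘ τ_{ρ,k+1} ∘ ⋯ ∘ τ_{ρ,k+m-1})(X),
  -- including that the composite of these partial functions is defined at X.
  _≈τ[_⋯+_]_ : Matrix Laurent q p → ℕ → ℕ → Matrix Laurent q p → Set (c ⊔ˡ ℓ₁)
  Y ≈τ[ k ⋯+ zero  ] X = Lift c (Y ≈ᴹ X)
  Y ≈τ[ k ⋯+ suc m ] X = Σ[ Z ∈ Matrix Laurent q p ] (Y ≈τ[ k ] Z) × (Z ≈τ[ suc k ⋯+ m ] X)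

{-# OPTIONS --safe #-}

-- Deleting the first row and column of H_n leaves the matrix H′ of size n - 1
-- built from the shifted sequences a^(k)_{m+1}.  Write
--   zI - H_n = ( α  -u ; -v  zI - H′ ),  G = (zI - H_n)⁻¹,  G′ = (zI - H′)⁻¹.
-- Block elimination with the Schur complement s = α - u G′ v gives
--   s G₀₀ = 1,  s G₀,ⱼ₊₁ = (u G′)ⱼ,  Gᵢ₊₁,₀ = (G′ v)ᵢ G₀₀,
--   Gᵢ₊₁,ⱼ₊₁ = G′ᵢⱼ + (G′ v)ᵢ G₀,ⱼ₊₁,
-- so the pseudo-quotient map T turns G into the matrix with blocks G′, -u G′, G′ v
-- and s, which is ρ₀ + ρ₀⁺ R′ ρ₀⁻.  Padding H_n with zeros up to a size at least
-- max(p, q) makes the indices beyond n - 1 obey the same identities.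
module Submission where

open import Defs
open import Algebra.Apartness.Bundles using (HeytingCommutativeRing; HeytingField)
open import Algebra.Bundles using (CommutativeRing)
import Algebra.Properties.Ring
import Algebra.Properties.Semiring.Sum
open import Data.Bool.Base using (if_then_else_; true; false; _∧_)
open import Data.Fin.Base using (Fin; zero; suc; toℕ; fromℕ; fromℕ<; inject₁; inject≤)
open import Data.Fin.Properties
  using (fromℕ≢inject₁; toℕ-inject≤; toℕ<n; toℕ-injective; toℕ-fromℕ<; toℕ-inject₁)
open import Data.Fin.Relation.Unary.Top using (view; ‵fromℕ; ‵inject₁; view-fromℕ; view-inject₁)
open import Data.Integer.Base as ℤ using (ℤ; +_; -[1+_])
import Data.Integer.Properties as ℤ
open import Data.Integer.Solver using (module +-*-Solver)
open import Data.Nat.Base as ℕ using (ℕ; zero; suc; _∸_; _⊔_; NonZero)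
import Data.Nat.Properties as ℕ
open import Data.Product.Base using (_,_)
open import Data.Sum.Base using (_⊎_; inj₁; inj₂)
open import Data.Vec.Functional using (Vector; updateAt)
open import Data.Vec.Functional.Properties using (updateAt-updates; updateAt-minimal)
open import Function.Base using (_∘_)
open import Level using (lift)
open import Relation.Binary.PropositionalEquality.Core as ≡ using (_≡_)
import Relation.Binary.Reasoning.Setoid
open import Relation.Nullary.Decidable using (dec-true; dec-false)
open import Relation.Nullary.Decidable.Core using (does; yes; no)

-- The commutative ring of formal Laurent series.

module LaurentRing {c ℓ} (F : CommutativeRing c ℓ) where
  open CommutativeRing F hiding (zero)
  open LaurentSeries rawRing
  open Algebra.Properties.Semiring.Sum semiring
    using (sum; sum-cong-≋; sum-replicate-zero; ∑-distrib-+; *-distribˡ-sum)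
  open Algebra.Properties.Ring ring using (-0#≈0#)
  open Relation.Binary.Reasoning.Setoid setoid

  private
    Digits : Set c
    Digits = ℕ → Carrier

    infixl 7 _⋆_

    -- The Cauchy product. It unfolds to the digits of `_*ᴸ_`, so each law for `_⋆_` becomes a law
    -- for series once the two tops agree.
    _⋆_ : Digits → Digits → Digits
    (x ⋆ y) i = sum {suc i} λ k → x (toℕ k) * y (i ∸ toℕ k)

    ⋆-cong : ∀ {x x′ y y′ : Digits} → (∀ i → x i ≈ x′ i) → (∀ i → y i ≈ y′ i) →
      ∀ i → (x ⋆ y) i ≈ (x′ ⋆ y′) i
    ⋆-cong x≈x′ y≈y′ i = sum-cong-≋ {suc i} λ k → *-cong (x≈x′ (toℕ k)) (y≈y′ (i ∸ toℕ k))

    -- The sum unfolds at `x 0`; splitting off the other end as well is what lets commutativity be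
    -- proved by induction.
    ⋆-last : ∀ x y i → (x ⋆ y) (suc i) ≈ (x ⋆ (λ j → y (suc j))) i + x (suc i) * y 0
    ⋆-last x y zero    = trans (sym (+-assoc _ _ _))
      (trans (+-identityʳ _) (sym (+-congʳ (+-identityʳ _))))
    ⋆-last x y (suc i) = trans (+-congˡ (⋆-last (λ j → x (suc j)) y i)) (sym (+-assoc _ _ _))

    ⋆-comm : ∀ x y i → (x ⋆ y) i ≈ (y ⋆ x) i
    ⋆-comm x y zero    = +-congʳ (*-comm _ _)
    ⋆-comm x y (suc i) = begin
      x 0 * y (suc i) + ((λ j → x (suc j)) ⋆ y) i  ≈⟨ +-cong (*-comm _ _) (⋆-comm (λ j → x (suc j)) y i) ⟩
      y (suc i) * x 0 + (y ⋆ (λ j → x (suc j))) i  ≈⟨ +-comm _ _ ⟩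
      (y ⋆ (λ j → x (suc j))) i + y (suc i) * x 0  ≈⟨ ⋆-last y x i ⟨
      (y ⋆ x) (suc i)                              ∎

    ⋆-distribʳ : ∀ w x y i → ((λ j → x j + y j) ⋆ w) i ≈ (x ⋆ w) i + (y ⋆ w) i
    ⋆-distribʳ w x y i = trans
      (sum-cong-≋ {suc i} λ k → distribʳ (w (i ∸ toℕ k)) (x (toℕ k)) (y (toℕ k)))
      (∑-distrib-+ {suc i} (λ k → x (toℕ k) * w (i ∸ toℕ k)) (λ k → y (toℕ k) * w (i ∸ toℕ k)))

    ⋆-scale : ∀ a x y i → ((λ j → a * x j) ⋆ y) i ≈ a * (x ⋆ y) i
    ⋆-scale a x y i = trans
      (sum-cong-≋ {suc i} λ k → *-assoc a (x (toℕ k)) (y (i ∸ toℕ k)))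
      (sym (*-distribˡ-sum {suc i} a λ k → x (toℕ k) * y (i ∸ toℕ k)))

    -- Induction on `i` for all `x`: peeling off `x 0` turns the tail of `x ⋆ y` into a multiple of
    -- the shifted `y` plus `x′ ⋆ y`, to which linearity and the induction hypothesis for `x′`
    -- apply.
    ⋆-assoc : ∀ x y w i → (x ⋆ y ⋆ w) i ≈ (x ⋆ (y ⋆ w)) i
    ⋆-assoc x y w zero    = begin
      (x 0 * y 0 + 0#) * w 0 + 0#    ≈⟨ +-congʳ (*-congʳ (+-identityʳ _)) ⟩
      x 0 * y 0 * w 0 + 0#           ≈⟨ +-congʳ (*-assoc _ _ _) ⟩
      x 0 * (y 0 * w 0) + 0#         ≈⟨ +-congʳ (*-congˡ (+-identityʳ _)) ⟨
      x 0 * (y 0 * w 0 + 0#) + 0#    ∎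
    ⋆-assoc x y w (suc i) = begin
      (x 0 * y 0 + 0#) * w (suc i) + ((λ j → x 0 * y (suc j) + (x′ ⋆ y) j) ⋆ w) i
        ≈⟨ +-cong (trans (*-congʳ (+-identityʳ _)) (*-assoc _ _ _))
                  (⋆-distribʳ w (λ j → x 0 * y (suc j)) (x′ ⋆ y) i) ⟩
      x 0 * (y 0 * w (suc i)) + (((λ j → x 0 * y (suc j)) ⋆ w) i + (x′ ⋆ y ⋆ w) i)
        ≈⟨ +-congˡ (+-cong (⋆-scale (x 0) (λ j → y (suc j)) w i) (⋆-assoc x′ y w i)) ⟩
      x 0 * (y 0 * w (suc i)) + (x 0 * ((λ j → y (suc j)) ⋆ w) i + (x′ ⋆ (y ⋆ w)) i)
        ≈⟨ +-assoc _ _ _ ⟨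
      x 0 * (y 0 * w (suc i)) + x 0 * ((λ j → y (suc j)) ⋆ w) i + (x′ ⋆ (y ⋆ w)) i
        ≈⟨ +-congʳ (distribˡ _ _ _) ⟨
      x 0 * (y ⋆ w) (suc i) + (x′ ⋆ (y ⋆ w)) i ∎
      where
      x′ : Digits
      x′ j = x (suc j)

    ⋆-identityˡ : ∀ x i → ((1# at 0) ⋆ x) i ≈ x i
    ⋆-identityˡ x i = trans (+-cong (*-identityˡ _)
        (trans (sum-cong-≋ {i} λ k → zeroˡ _) (sum-replicate-zero i)))
      (+-identityʳ _)

    shift : ℕ → Digits → Digits
    shift zero    x i       = x i
    shift (suc s) x zero    = 0#
    shift (suc s) x (suc i) = shift s x i

    shift-⋆ : ∀ s x y i → (shift s x ⋆ y) i ≈ shift s (x ⋆ y) i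
    shift-⋆ zero    x y i       = refl
    shift-⋆ (suc s) x y zero    = trans (+-identityʳ _) (zeroˡ _)
    shift-⋆ (suc s) x y (suc i) =
      trans (+-cong (zeroˡ _) (shift-⋆ s x y i)) (+-identityˡ _)

    digitℤ-cong : ∀ {x y : Digits} → (∀ i → x i ≈ y i) → ∀ k → digitℤ x k ≈ digitℤ y k
    digitℤ-cong x≈y (+ i)    = x≈y i
    digitℤ-cong x≈y -[1+ _ ] = refl

    -- For negative `k` the index `s + k` is either negative or the position of one of the `s`
    -- inserted zeros, so both sides vanish.
    digitℤ-shift : ∀ s x k → digitℤ (shift s x) (+ s ℤ.+ k) ≡ digitℤ x k
    digitℤ-shift zero    x k        = ≡.cong (digitℤ x) (ℤ.+-identityˡ k)
    digitℤ-shift (suc s) x k        = ≡.trans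
      (≡.trans (≡.cong (digitℤ (shift (suc s) x)) (ℤ.+-assoc (+ 1) (+ s) k)) (shift-suc (+ s ℤ.+ k)))
      (digitℤ-shift s x k)
      where
      shift-suc : ∀ k → digitℤ (shift (suc s) x) (ℤ.suc k) ≡ digitℤ (shift s x) k
      shift-suc (+ _)        = ≡.refl
      shift-suc -[1+ zero ]  = ≡.refl
      shift-suc -[1+ suc _ ] = ≡.refl

    -- A change of representative: the top rises by `s` and `s` leading zeros compensate. Any two
    -- series acquire a common top this way.
    raise : ℕ → Laurent → Laurent
    raise s f = laurent (s ℕ.+ top f) (shift s (digit f))

    reflᴸ : ∀ {f} → f ≈ᴸ f
    reflᴸ m = refl

    symᴸ : ∀ {f g} → f ≈ᴸ g → g ≈ᴸ f
    symᴸ f≈g m = sym (f≈g m)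

    transᴸ : ∀ {f g h} → f ≈ᴸ g → g ≈ᴸ h → f ≈ᴸ h
    transᴸ f≈g g≈h m = trans (f≈g m) (g≈h m)

    raise-≈ : ∀ s f → raise s f ≈ᴸ f
    raise-≈ s f m = reflexive (≡.trans
      (≡.cong (digitℤ (shift s (digit f))) (ℤ.+-assoc (+ s) (+ top f) (ℤ.- m)))
      (digitℤ-shift s (digit f) (+ top f ℤ.- m)))

  digit⇒≈ᴸ : ∀ {f g} → top f ≡ top g → (∀ i → digit f i ≈ digit g i) → f ≈ᴸ g
  digit⇒≈ᴸ {f} ≡.refl f≈g m = digitℤ-cong f≈g (+ top f ℤ.- m)

  private
    ≈ᴸ⇒digit : ∀ {f g} → top f ≡ top g → f ≈ᴸ g → ∀ i → digit f i ≈ digit g i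
    ≈ᴸ⇒digit {f} {g} ≡.refl f≈g i =
      ≡.subst (λ k → digitℤ (digit f) k ≈ digitℤ (digit g) k)
        (solve 2 (λ t i → t :- (t :- i) := i) ≡.refl (+ top f) (+ i))
        (f≈g (+ top f ℤ.- + i))
      where open +-*-Solver

    raise-*ᴸ : ∀ s f g → raise s f *ᴸ g ≈ᴸ raise s (f *ᴸ g)
    raise-*ᴸ s f g = digit⇒≈ᴸ (ℕ.+-assoc s (top f) (top g)) (shift-⋆ s (digit f) (digit g))

    *ᴸ-comm : ∀ f g → f *ᴸ g ≈ᴸ g *ᴸ f
    *ᴸ-comm f g = digit⇒≈ᴸ (ℕ.+-comm (top f) (top g)) (⋆-comm (digit f) (digit g))

    -- Representatives with a common top have equal digits.
    *ᴸ-congʳ : ∀ {f f′} g → f ≈ᴸ f′ → f *ᴸ g ≈ᴸ f′ *ᴸ g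
    *ᴸ-congʳ {f} {f′} g f≈f′ =
      transᴸ (symᴸ (raise-≈ (top f′) (f *ᴸ g)))
      (transᴸ (symᴸ (raise-*ᴸ (top f′) f g))
      (transᴸ (digit⇒≈ᴸ (≡.cong (ℕ._+ top g) tops)
        (⋆-cong (≈ᴸ⇒digit tops (transᴸ (raise-≈ (top f′) f) (transᴸ f≈f′ (symᴸ (raise-≈ (top f) f′)))))
                (λ _ → refl)))
      (transᴸ (raise-*ᴸ (top f) f′ g)
      (raise-≈ (top f) (f′ *ᴸ g)))))
      where
      tops : top f′ ℕ.+ top f ≡ top f ℕ.+ top f′
      tops = ℕ.+-comm (top f′) (top f)

    *ᴸ-cong : ∀ {f f′ g g′} → f ≈ᴸ f′ → g ≈ᴸ g′ → f *ᴸ g ≈ᴸ f′ *ᴸ g′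
    *ᴸ-cong {f} {f′} {g} {g′} f≈f′ g≈g′ = transᴸ (*ᴸ-congʳ g f≈f′)
      (transᴸ (*ᴸ-comm f′ g) (transᴸ (*ᴸ-congʳ f′ g≈g′) (*ᴸ-comm g′ f′)))

    digitℤ-neg : ∀ x {k} → k ℤ.< + 0 → digitℤ x k ≡ 0#
    digitℤ-neg x ℤ.-<+       = ≡.refl
    digitℤ-neg x (ℤ.+<+ ())

    coeff-above : ∀ f {t m} → top f ℕ.≤ t → + t ℤ.- m ℤ.< + 0 → coeff f m ≡ 0#
    coeff-above f {t} {m} f≤t t<m = digitℤ-neg (digit f)
      (ℤ.≤-<-trans (ℤ.+-monoˡ-≤ (ℤ.- m) (ℤ.+≤+ f≤t)) t<m)

    -- If `t - m` is nonnegative, the digit there is a sum of coefficients at `t - (t - m) = m`;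
    -- otherwise `m` exceeds both tops and everything is zero.
    coeff-+ : ∀ f g m → coeff (f +ᴸ g) m ≈ coeff f m + coeff g m
    coeff-+ f g m = go _ ≡.refl
      where
      t = top f ⊔ top g
      go : ∀ y → + t ℤ.- m ≡ y → digitℤ (digit (f +ᴸ g)) y ≈ coeff f m + coeff g m
      go (+ i)    eq = reflexive (≡.cong (λ k → coeff f k + coeff g k)
        (≡.trans (≡.cong (λ k → + t ℤ.- k) (≡.sym eq))
                 (solve 2 (λ t m → t :- (t :- m) := m) ≡.refl (+ t) m)))
        where open +-*-Solver
      go -[1+ i ] eq = sym (trans
        (+-cong (reflexive (coeff-above f {m = m} (ℕ.m≤m⊔n (top f) (top g)) neg))
                (reflexive (coeff-above g {m = m} (ℕ.m≤n⊔m (top f) (top g)) neg)))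
        (+-identityˡ 0#))
        where
        neg : + t ℤ.- m ℤ.< + 0
        neg = ≡.subst (ℤ._< + 0) (≡.sym eq) ℤ.-<+

    +ᴸ-cong : ∀ {f f′ g g′} → f ≈ᴸ f′ → g ≈ᴸ g′ → f +ᴸ g ≈ᴸ f′ +ᴸ g′
    +ᴸ-cong {f} {f′} {g} {g′} f≈f′ g≈g′ m =
      trans (coeff-+ f g m) (trans (+-cong (f≈f′ m) (g≈g′ m)) (sym (coeff-+ f′ g′ m)))

    +ᴸ-sameTop : ∀ t x y → laurent t x +ᴸ laurent t y ≈ᴸ laurent t (λ i → x i + y i)
    +ᴸ-sameTop t x y m = trans (coeff-+ (laurent t x) (laurent t y) m) (digitℤ-+ (+ t ℤ.- m))
      where
      digitℤ-+ : ∀ k → digitℤ x k + digitℤ y k ≈ digitℤ (λ i → x i + y i) k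
      digitℤ-+ (+ _)    = refl
      digitℤ-+ -[1+ _ ] = +-identityˡ 0#

    *ᴸ-distribʳ : ∀ h f g → (f +ᴸ g) *ᴸ h ≈ᴸ (f *ᴸ h) +ᴸ (g *ᴸ h)
    *ᴸ-distribʳ h f g =
      transᴸ (*ᴸ-congʳ h (transᴸ (+ᴸ-cong f≈ g≈) (+ᴸ-sameTop t x y)))
      (transᴸ (digit⇒≈ᴸ ≡.refl (⋆-distribʳ (digit h) x y))
      (transᴸ (symᴸ (+ᴸ-sameTop (t ℕ.+ top h) (x ⋆ digit h) (y ⋆ digit h)))
      (symᴸ (+ᴸ-cong (*ᴸ-congʳ h f≈) (*ᴸ-congʳ h g≈)))))
      where
      -- The sum of the tops instead of their maximum: each shift is then by the other top, with no
      -- subtraction.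
      t = top f ℕ.+ top g
      x = shift (top g) (digit f)
      y = shift (top f) (digit g)
      f≈ : f ≈ᴸ laurent t x
      f≈ = transᴸ (symᴸ (raise-≈ (top g) f))
                  (digit⇒≈ᴸ (ℕ.+-comm (top g) (top f)) (λ _ → refl))
      g≈ : g ≈ᴸ laurent t y
      g≈ = symᴸ (raise-≈ (top f) g)

    coeff-0 : ∀ m → coeff (constant 0#) m ≈ 0#
    coeff-0 m = go (+ 0 ℤ.- m)
      where
      go : ∀ k → digitℤ (0# at 0) k ≈ 0#
      go (+ zero)  = refl
      go (+ suc _) = refl
      go -[1+ _ ]  = refl

    coeff-neg : ∀ f m → coeff (-ᴸ f) m ≈ - coeff f m
    coeff-neg f m = go (+ top f ℤ.- m)
      where
      go : ∀ k → digitℤ (digit (-ᴸ f)) k ≈ - digitℤ (digit f) k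
      go (+ _)    = refl
      go -[1+ _ ] = sym -0#≈0#

    +ᴸ-identityˡ : ∀ f → constant 0# +ᴸ f ≈ᴸ f
    +ᴸ-identityˡ f m = trans (coeff-+ (constant 0#) f m) (trans (+-congʳ (coeff-0 m)) (+-identityˡ _))

    +ᴸ-comm : ∀ f g → f +ᴸ g ≈ᴸ g +ᴸ f
    +ᴸ-comm f g m = trans (coeff-+ f g m) (trans (+-comm _ _) (sym (coeff-+ g f m)))

    +ᴸ-assoc : ∀ f g h → (f +ᴸ g) +ᴸ h ≈ᴸ f +ᴸ (g +ᴸ h)
    +ᴸ-assoc f g h m = begin
      coeff ((f +ᴸ g) +ᴸ h) m              ≈⟨ coeff-+ (f +ᴸ g) h m ⟩
      coeff (f +ᴸ g) m + coeff h m         ≈⟨ +-congʳ (coeff-+ f g m) ⟩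
      coeff f m + coeff g m + coeff h m    ≈⟨ +-assoc _ _ _ ⟩
      coeff f m + (coeff g m + coeff h m)  ≈⟨ +-congˡ (coeff-+ g h m) ⟨
      coeff f m + coeff (g +ᴸ h) m         ≈⟨ coeff-+ f (g +ᴸ h) m ⟨
      coeff (f +ᴸ (g +ᴸ h)) m              ∎

    -ᴸ-inverseˡ : ∀ f → (-ᴸ f) +ᴸ f ≈ᴸ constant 0#
    -ᴸ-inverseˡ f m = begin
      coeff ((-ᴸ f) +ᴸ f) m        ≈⟨ coeff-+ (-ᴸ f) f m ⟩
      coeff (-ᴸ f) m + coeff f m   ≈⟨ +-congʳ (coeff-neg f m) ⟩
      - coeff f m + coeff f m      ≈⟨ -‿inverseˡ _ ⟩
      0#                           ≈⟨ coeff-0 m ⟨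
      coeff (constant 0#) m        ∎

    *ᴸ-assoc : ∀ f g h → (f *ᴸ g) *ᴸ h ≈ᴸ f *ᴸ (g *ᴸ h)
    *ᴸ-assoc f g h = digit⇒≈ᴸ (ℕ.+-assoc (top f) (top g) (top h))
      (⋆-assoc (digit f) (digit g) (digit h))

    *ᴸ-identityˡ : ∀ f → constant 1# *ᴸ f ≈ᴸ f
    *ᴸ-identityˡ f = digit⇒≈ᴸ ≡.refl (⋆-identityˡ (digit f))

  -- The operations are those of the raw ring of series, so matrix constructions over either one
  -- coincide definitionally.
  laurentCommutativeRing : CommutativeRing c ℓ
  laurentCommutativeRing = record
    { Carrier = Laurent ; _≈_ = _≈ᴸ_ ; _+_ = _+ᴸ_ ; _*_ = _*ᴸ_ ; -_ = -ᴸ_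
    ; 0# = constant 0# ; 1# = constant 1#
    ; isCommutativeRing = record
      { isRing = record
        { +-isAbelianGroup = record
          { isGroup = record
            { isMonoid = record
              { isSemigroup = record
                { isMagma = record
                  { isEquivalence = record
                    { refl  = λ {f} → reflᴸ {f}
                    ; sym   = λ {f} {g} → symᴸ {f} {g}
                    ; trans = λ {f} {g} {h} → transᴸ {f} {g} {h} }
                  ; ∙-cong = λ {f} {f′} {g} {g′} → +ᴸ-cong {f} {f′} {g} {g′} }
                ; assoc = +ᴸ-assoc }
              ; identity = +ᴸ-identityˡ ,
                  λ f → transᴸ (+ᴸ-comm f (constant 0#)) (+ᴸ-identityˡ f) }
            ; inverse = -ᴸ-inverseˡ ,
                λ f → transᴸ (+ᴸ-comm f (-ᴸ f)) (-ᴸ-inverseˡ f)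
            ; ⁻¹-cong = λ {f} {g} f≈g m →
                trans (coeff-neg f m) (trans (-‿cong (f≈g m)) (sym (coeff-neg g m))) }
          ; comm = +ᴸ-comm }
        ; *-cong = λ {f} {f′} {g} {g′} → *ᴸ-cong {f} {f′} {g} {g′}
        ; *-assoc = *ᴸ-assoc
        ; *-identity = *ᴸ-identityˡ ,
            λ f → transᴸ (*ᴸ-comm f (constant 1#)) (*ᴸ-identityˡ f)
        ; distrib = (λ h f g → transᴸ (*ᴸ-comm h (f +ᴸ g)) (transᴸ (*ᴸ-distribʳ h f g)
                       (+ᴸ-cong (*ᴸ-comm f h) (*ᴸ-comm g h)))) ,
                    *ᴸ-distribʳ }
      ; *-comm = *ᴸ-comm } }

-- Finite sums and bordered matrices over a commutative ring.

module MatrixProperties {c ℓ} (R : CommutativeRing c ℓ) where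
  open CommutativeRing R hiding (zero)
  open MatrixAlgebra rawRing
  open Algebra.Properties.Semiring.Sum semiring
    using (sum; sum-cong-≋; sum-replicate-zero; ∑-distrib-+; ∑-comm; *-distribˡ-sum; *-distribʳ-sum)
  open Algebra.Properties.Ring ring using (-‿distribˡ-*; -0#≈0#; -‿+-comm)
  open Relation.Binary.Reasoning.Setoid setoid

  sum-zero : ∀ {n} (f : Vector Carrier n) → (∀ k → f k ≈ 0#) → sum f ≈ 0#
  sum-zero {n} f f≈0 = trans (sum-cong-≋ f≈0) (sum-replicate-zero n)

  -- The truncation tool: it discards the zeros of a padded matrix, and the entries beyond the band
  -- in a first row or column.
  sum-inject≤ : ∀ {m n} (m≤n : m ℕ.≤ n) (f : Vector Carrier n) →
    (∀ k → m ℕ.≤ toℕ k → f k ≈ 0#) → sum f ≈ sum (λ k → f (inject≤ k m≤n))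
  sum-inject≤ ℕ.z≤n       f f≈0 = sum-zero f λ k → f≈0 k ℕ.z≤n
  sum-inject≤ (ℕ.s≤s m≤n) f f≈0 =
    +-congˡ (sum-inject≤ m≤n (f ∘ suc) λ k m≤k → f≈0 (suc k) (ℕ.s≤s m≤k))

  1ᴹ-sym : ∀ {n} (i j : Fin n) → 1ᴹ i j ≡ 1ᴹ j i
  1ᴹ-sym zero    zero    = ≡.refl
  1ᴹ-sym zero    (suc j) = ≡.refl
  1ᴹ-sym (suc i) zero    = ≡.refl
  1ᴹ-sym (suc i) (suc j) = 1ᴹ-sym i j

  sum-1ᴹˡ : ∀ {n} (i : Fin n) (f : Vector Carrier n) → sum (λ k → 1ᴹ i k * f k) ≈ f i
  sum-1ᴹˡ zero f = trans
    (+-cong (*-identityˡ _) (sum-zero (λ k → 0# * f (suc k)) λ k → zeroˡ _)) (+-identityʳ _)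
  sum-1ᴹˡ (suc i) f = trans (+-cong (zeroˡ _) (sum-1ᴹˡ i (f ∘ suc))) (+-identityˡ _)

  sum-1ᴹʳ : ∀ {n} (j : Fin n) (f : Vector Carrier n) → sum (λ k → f k * 1ᴹ k j) ≈ f j
  sum-1ᴹʳ j f = trans
    (sum-cong-≋ λ k → trans (*-comm _ _) (*-congʳ (reflexive (1ᴹ-sym k j)))) (sum-1ᴹˡ j f)

  sum-neg : ∀ {n} (f g : Vector Carrier n) → sum (λ k → - f k * g k) ≈ - sum (λ k → f k * g k)
  sum-neg {zero}  f g = sym -0#≈0#
  sum-neg {suc n} f g =
    trans (+-cong (sym (-‿distribˡ-* _ _)) (sum-neg (f ∘ suc) (g ∘ suc))) (-‿+-comm _ _)

  sum-assoc : ∀ {m n} (x : Vector Carrier m) (A : Matrix Carrier m n) (y : Vector Carrier n) →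
    sum (λ i → x i * sum (λ j → A i j * y j)) ≈ sum (λ j → sum (λ i → x i * A i j) * y j)
  sum-assoc x A y = begin
    sum (λ i → x i * sum (λ j → A i j * y j))
      ≈⟨ sum-cong-≋ (λ i → *-distribˡ-sum (x i) (λ j → A i j * y j)) ⟩
    sum (λ i → sum (λ j → x i * (A i j * y j)))
      ≈⟨ ∑-comm (λ i j → x i * (A i j * y j)) ⟩
    sum (λ j → sum (λ i → x i * (A i j * y j)))
      ≈⟨ sum-cong-≋ (λ j → sum-cong-≋ λ i → *-assoc (x i) (A i j) (y j)) ⟨
    sum (λ j → sum (λ i → x i * A i j * y j))
      ≈⟨ sum-cong-≋ (λ j → *-distribʳ-sum (y j) (λ i → x i * A i j)) ⟨
    sum (λ j → sum (λ i → x i * A i j) * y j) ∎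

  +-neg⇒≈ : ∀ {x y r} → - y + x ≈ r → x ≈ r + y
  +-neg⇒≈ {x} {y} {r} eq = begin
    x              ≈⟨ +-identityʳ x ⟨
    x + 0#         ≈⟨ +-congˡ (-‿inverseˡ y) ⟨
    x + (- y + y)  ≈⟨ +-assoc _ _ _ ⟨
    x + - y + y    ≈⟨ +-congʳ (trans (+-comm _ _) eq) ⟩
    r + y          ∎

  module _ {m n} {body : Matrix Carrier m n} {row : Vector Carrier n} {col : Vector Carrier m}
    {corner : Carrier} (B : Matrix Carrier (suc m) (suc n))
    (body-≈ : ∀ i j → body i j ≈ B (inject₁ i) (inject₁ j))
    (row-≈ : ∀ j → row j ≈ B (fromℕ m) (inject₁ j))
    (col-≈ : ∀ i → col i ≈ B (inject₁ i) (fromℕ n))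
    (corner-≈ : corner ≈ B (fromℕ m) (fromℕ n)) where

    bordered-≈ : bordered body row col corner ≈ᴹ B
    bordered-≈ i j with view i | view j
    ... | ‵inject₁ i′ | ‵inject₁ j′ = body-≈ i′ j′
    ... | ‵fromℕ      | ‵inject₁ j′ = row-≈ j′
    ... | ‵inject₁ i′ | ‵fromℕ      = col-≈ i′
    ... | ‵fromℕ      | ‵fromℕ      = corner-≈

  module _ {m n} (X : Matrix Carrier (suc m) (suc n)) (α : Carrier)
    (r : Vector Carrier (suc m)) (s : Vector Carrier (suc n)) where
    private
      ρ : Matrix Carrier (suc m) (suc n)
      ρ = bordered (λ _ _ → 0#) (λ _ → 0#) (λ _ → 0#) α

      ρ⁺ : Matrix Carrier (suc m) (suc m)
      ρ⁺ = updateAt 1ᴹ (fromℕ m) λ _ → r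

      ρ⁻ : Matrix Carrier (suc n) (suc n)
      ρ⁻ i = updateAt (1ᴹ i) (fromℕ n) λ _ → s i

      ρ⁺X-upper : ∀ i j → (ρ⁺ *ᴹ X) (inject₁ i) j ≈ X (inject₁ i) j
      ρ⁺X-upper i j = begin
        sum (λ k → ρ⁺ (inject₁ i) k * X k j)
          ≡⟨ ≡.cong (λ x → sum λ k → x k * X k j)
               (updateAt-minimal (inject₁ i) (fromℕ m) 1ᴹ (fromℕ≢inject₁ ∘ ≡.sym)) ⟩
        sum (λ k → 1ᴹ (inject₁ i) k * X k j)
          ≈⟨ sum-1ᴹˡ (inject₁ i) (λ k → X k j) ⟩
        X (inject₁ i) j ∎

      ρ⁺X-last : ∀ j → (ρ⁺ *ᴹ X) (fromℕ m) j ≈ sum λ k → r k * X k j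
      ρ⁺X-last j = reflexive (≡.cong (λ x → sum λ k → x k * X k j)
        (updateAt-updates (fromℕ m) 1ᴹ))

      Yρ⁻-left : ∀ {l} (Y : Matrix Carrier l (suc n)) i j →
        (Y *ᴹ ρ⁻) i (inject₁ j) ≈ Y i (inject₁ j)
      Yρ⁻-left Y i j = begin
        sum (λ k → Y i k * ρ⁻ k (inject₁ j))
          ≈⟨ sum-cong-≋ (λ k → *-congˡ {Y i k} (reflexive
               (updateAt-minimal (inject₁ j) (fromℕ n) {λ _ → s k} (1ᴹ k) (fromℕ≢inject₁ ∘ ≡.sym)))) ⟩
        sum (λ k → Y i k * 1ᴹ k (inject₁ j))
          ≈⟨ sum-1ᴹʳ (inject₁ j) (Y i) ⟩
        Y i (inject₁ j) ∎

      Yρ⁻-last : ∀ {l} (Y : Matrix Carrier l (suc n)) i →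
        (Y *ᴹ ρ⁻) i (fromℕ n) ≈ sum λ k → Y i k * s k
      Yρ⁻-last Y i = sum-cong-≋ λ k → *-congˡ {Y i k}
        (reflexive (updateAt-updates (fromℕ n) {λ _ → s k} (1ᴹ k)))

    -- `ρ⁺` only replaces the last row of `X` by `r X`, `ρ⁻` only replaces the last column of a
    -- matrix `Y` by `Y s`, and `ρ` only contributes `α` in the corner. Hence the four blocks come
    -- from `X`, `r X`, `X s` and `α + r X s`.
    bordered-≈-τ : ∀ {body : Matrix Carrier m n} {row col corner} →
      (∀ i j → body i j ≈ X (inject₁ i) (inject₁ j)) →
      (∀ j → row j ≈ sum λ k → r k * X k (inject₁ j)) →
      (∀ i → col i ≈ sum λ k → X (inject₁ i) k * s k) →
      corner ≈ α + sum (λ l → sum (λ k → r k * X k l) * s l) →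
      bordered body row col corner ≈ᴹ ρ +ᴹ ρ⁺ *ᴹ X *ᴹ ρ⁻
    bordered-≈-τ body-≈ row-≈ col-≈ corner-≈ = bordered-≈ (ρ +ᴹ ρ⁺ *ᴹ X *ᴹ ρ⁻)
      (λ i j → trans (body-≈ i j) (sym (0+ (ρ-body i j)
        (trans (Yρ⁻-left (ρ⁺ *ᴹ X) (inject₁ i) j) (ρ⁺X-upper i (inject₁ j))))))
      (λ j → trans (row-≈ j) (sym (0+ (ρ-row j)
        (trans (Yρ⁻-left (ρ⁺ *ᴹ X) (fromℕ m) j) (ρ⁺X-last (inject₁ j))))))
      (λ i → trans (col-≈ i) (sym (0+ (ρ-col i)
        (trans (Yρ⁻-last (ρ⁺ *ᴹ X) (inject₁ i)) (sum-cong-≋ λ k → *-congʳ {s k} (ρ⁺X-upper i k))))))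
      (trans corner-≈ (sym (+-cong (reflexive ρ-corner)
        (trans (Yρ⁻-last (ρ⁺ *ᴹ X) (fromℕ m)) (sum-cong-≋ λ k → *-congʳ {s k} (ρ⁺X-last k))))))
      where
      0+ : ∀ {x y w} → x ≡ 0# → y ≈ w → x + y ≈ w
      0+ ≡.refl y≈w = trans (+-identityˡ _) y≈w
      ρ-body : ∀ i j → ρ (inject₁ i) (inject₁ j) ≡ 0#
      ρ-body i j rewrite view-inject₁ i | view-inject₁ j = ≡.refl
      ρ-row : ∀ j → ρ (fromℕ m) (inject₁ j) ≡ 0#
      ρ-row j rewrite view-fromℕ m | view-inject₁ j = ≡.refl
      ρ-col : ∀ i → ρ (inject₁ i) (fromℕ n) ≡ 0#
      ρ-col i rewrite view-inject₁ i | view-fromℕ n = ≡.refl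
      ρ-corner : ρ (fromℕ m) (fromℕ n) ≡ α
      ρ-corner rewrite view-fromℕ m | view-fromℕ n = ≡.refl

  -- Block elimination and the Schur complement.

  module BlockInverse {n}
    (M G : Matrix Carrier (suc n) (suc n)) (M′ G′ : Matrix Carrier n n)
    (α : Carrier) (u v : Vector Carrier n)
    (M₀₀ : M zero zero ≈ α) (M₀ⱼ : ∀ j → M zero (suc j) ≈ - u j)
    (Mᵢ₀ : ∀ i → M (suc i) zero ≈ - v i) (Mᵢⱼ : ∀ i j → M (suc i) (suc j) ≈ M′ i j)
    (MG≈1 : M *ᴹ G ≈ᴹ 1ᴹ) (G′M′≈1 : G′ *ᴹ M′ ≈ᴹ 1ᴹ) where

    uG′ G′v : Vector Carrier n
    uG′ j = sum λ i → u i * G′ i j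
    G′v i = sum λ j → G′ i j * v j

    schur : Carrier
    schur = α + - sum (λ j → uG′ j * v j)

    -- Row `suc i` of `M G = 1`, with the contribution of the first column of `M` moved to the
    -- right.
    lower : ∀ i j → sum (λ l → M′ i l * G (suc l) j) ≈ 1ᴹ (suc i) j + v i * G zero j
    lower i j = +-neg⇒≈ (begin
      - (v i * G zero j) + sum (λ l → M′ i l * G (suc l) j)
        ≈⟨ +-congʳ (-‿distribˡ-* _ _) ⟩
      - v i * G zero j + sum (λ l → M′ i l * G (suc l) j)
        ≈⟨ +-cong (*-congʳ (Mᵢ₀ i)) (sum-cong-≋ λ l → *-congʳ (Mᵢⱼ i l)) ⟨
      sum (λ k → M (suc i) k * G k j)
        ≈⟨ MG≈1 (suc i) j ⟩
      1ᴹ (suc i) j ∎)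

    -- Multiplying `lower` by `G′` on the left cancels `M′`. Keeping `j` arbitrary serves two cases:
    -- the sum with `1ᴹ (suc l) j` vanishes for `j = zero` and collapses to an entry of `G′`
    -- otherwise.
    solved : ∀ i j → G (suc i) j ≈ sum (λ l → G′ i l * 1ᴹ (suc l) j) + G′v i * G zero j
    solved i j = begin
      G (suc i) j
        ≈⟨ sum-1ᴹˡ i (λ l → G (suc l) j) ⟨
      sum (λ l → 1ᴹ i l * G (suc l) j)
        ≈⟨ sum-cong-≋ (λ l → *-congʳ (G′M′≈1 i l)) ⟨
      sum (λ l → sum (λ k → G′ i k * M′ k l) * G (suc l) j)
        ≈⟨ sum-assoc (G′ i) M′ (λ l → G (suc l) j) ⟨
      sum (λ k → G′ i k * sum (λ l → M′ k l * G (suc l) j))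
        ≈⟨ sum-cong-≋ (λ k → *-congˡ (lower k j)) ⟩
      sum (λ k → G′ i k * (1ᴹ (suc k) j + v k * G zero j))
        ≈⟨ sum-cong-≋ (λ k → trans (distribˡ (G′ i k) (1ᴹ (suc k) j) (v k * G zero j))
                                   (+-congˡ (sym (*-assoc (G′ i k) (v k) (G zero j))))) ⟩
      sum (λ k → G′ i k * 1ᴹ (suc k) j + G′ i k * v k * G zero j)
        ≈⟨ ∑-distrib-+ (λ k → G′ i k * 1ᴹ (suc k) j) _ ⟩
      sum (λ k → G′ i k * 1ᴹ (suc k) j) + sum (λ k → G′ i k * v k * G zero j)
        ≈⟨ +-congˡ (*-distribʳ-sum (G zero j) (λ k → G′ i k * v k)) ⟨
      sum (λ k → G′ i k * 1ᴹ (suc k) j) + G′v i * G zero j ∎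

    column : ∀ i → G (suc i) zero ≈ G′v i * G zero zero
    column i = trans (solved i zero)
      (trans (+-congʳ (sum-zero (λ l → G′ i l * 0#) λ l → zeroʳ _)) (+-identityˡ _))

    body : ∀ i j → G (suc i) (suc j) ≈ G′ i j + G′v i * G zero (suc j)
    body i j = trans (solved i (suc j)) (+-congʳ (sum-1ᴹʳ j (G′ i)))

    -- Substituting `solved` into row zero of `M G = 1` produces a term `s * g` on the right, which
    -- the Schur complement `α - s` absorbs.
    top-row : ∀ j →
      schur * G zero j ≈ 1ᴹ zero j + sum (λ l → u l * sum (λ k → G′ l k * 1ᴹ (suc k) j))
    top-row j = begin
      (α + - s) * g                        ≈⟨ distribʳ _ _ _ ⟩
      α * g + - s * g                      ≈⟨ +-congʳ row₀ ⟩
      1ᴹ zero j + (e + s * g) + - s * g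
        ≈⟨ +-cong (sym (+-assoc _ _ _)) (sym (-‿distribˡ-* s g)) ⟩
      1ᴹ zero j + e + s * g + - (s * g)    ≈⟨ +-assoc _ _ _ ⟩
      1ᴹ zero j + e + (s * g + - (s * g))  ≈⟨ +-congˡ (-‿inverseʳ _) ⟩
      1ᴹ zero j + e + 0#                   ≈⟨ +-identityʳ _ ⟩
      1ᴹ zero j + e                        ∎
      where
      g s e : Carrier
      g = G zero j
      s = sum (λ l → uG′ l * v l)
      e = sum (λ l → u l * sum (λ k → G′ l k * 1ᴹ (suc k) j))
      u∙G : sum (λ l → u l * G (suc l) j) ≈ e + s * g
      u∙G = begin
        sum (λ l → u l * G (suc l) j)
          ≈⟨ sum-cong-≋ (λ l → trans (*-congˡ (solved l j))
                (trans (distribˡ _ _ _) (+-congˡ (sym (*-assoc _ _ _))))) ⟩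
        sum (λ l → u l * sum (λ k → G′ l k * 1ᴹ (suc k) j) + u l * G′v l * g)
          ≈⟨ ∑-distrib-+ (λ l → u l * sum (λ k → G′ l k * 1ᴹ (suc k) j)) _ ⟩
        e + sum (λ l → u l * G′v l * g)
          ≈⟨ +-congˡ (*-distribʳ-sum g (λ l → u l * G′v l)) ⟨
        e + sum (λ l → u l * G′v l) * g
          ≈⟨ +-congˡ (*-congʳ (sum-assoc u G′ v)) ⟩
        e + s * g ∎
      row₀ : α * g ≈ 1ᴹ zero j + (e + s * g)
      row₀ = trans (+-neg⇒≈ (begin
        - sum (λ l → u l * G (suc l) j) + α * g
          ≈⟨ +-congʳ (sum-neg u (λ l → G (suc l) j)) ⟨
        sum (λ l → - u l * G (suc l) j) + α * g
          ≈⟨ +-comm _ _ ⟩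
        α * g + sum (λ l → - u l * G (suc l) j)
          ≈⟨ +-cong (*-congʳ M₀₀) (sum-cong-≋ λ l → *-congʳ (M₀ⱼ l)) ⟨
        sum (λ k → M zero k * G k j)
          ≈⟨ MG≈1 zero j ⟩
        1ᴹ zero j ∎)) (+-congˡ u∙G)

    -- The invertibility that `T` demands comes from `top-row` at `zero`, where every
    -- `1ᴹ (suc k) zero` is zero.
    schur-inverseˡ : schur * G zero zero ≈ 1#
    schur-inverseˡ = trans (top-row zero) (trans (+-congˡ
      (sum-zero (λ l → u l * sum (λ k → G′ l k * 0#))
        λ l → trans (*-congˡ (sum-zero (λ k → G′ l k * 0#) λ k → zeroʳ _)) (zeroʳ _)))
      (+-identityʳ _))

    row : ∀ j → schur * G zero (suc j) ≈ uG′ j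
    row j = trans (top-row (suc j)) (trans (+-identityˡ _)
      (sum-cong-≋ λ l → *-congˡ (sum-1ᴹʳ j (G′ l))))

    -- By `body` and `column`, both products contain the rank-one term `G′v i * r * g`. It cancels,
    -- and `schur` then removes the factor `g` left on `G′ i j`.
    minor : ∀ i j →
      (G (suc i) (suc j) * G zero zero + - (G zero (suc j) * G (suc i) zero)) * schur ≈ G′ i j
    minor i j = begin
      (G (suc i) (suc j) * g + - (r * G (suc i) zero)) * schur
        ≈⟨ *-congʳ (+-cong (trans (*-congʳ (body i j)) (distribʳ _ _ _)) (-‿cong cross)) ⟩
      (G′ i j * g + G′v i * r * g + - (G′v i * r * g)) * schur
        ≈⟨ *-congʳ (trans (+-assoc _ _ _) (trans (+-congˡ (-‿inverseʳ _)) (+-identityʳ _))) ⟩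
      G′ i j * g * schur
        ≈⟨ *-assoc _ _ _ ⟩
      G′ i j * (g * schur)
        ≈⟨ *-congˡ (trans (*-comm _ _) schur-inverseˡ) ⟩
      G′ i j * 1#
        ≈⟨ *-identityʳ _ ⟩
      G′ i j ∎
      where
      g r : Carrier
      g = G zero zero
      r = G zero (suc j)
      cross : r * G (suc i) zero ≈ G′v i * r * g
      cross = begin
        r * G (suc i) zero  ≈⟨ *-congˡ (column i) ⟩
        r * (G′v i * g)     ≈⟨ *-assoc _ _ _ ⟨
        r * G′v i * g       ≈⟨ *-congʳ (*-comm _ _) ⟩
        G′v i * r * g       ∎

    -- Restriction to the `q × p` corner, and the map `T`.

    module PseudoQuotient {p-1 q-1 : ℕ} (p≤n : suc p-1 ℕ.≤ n) (q≤n : suc q-1 ℕ.≤ n) where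
      private
        ιp : Fin (suc p-1) → Fin n
        ιp j = inject≤ j p≤n

        ιq : Fin (suc q-1) → Fin n
        ιq i = inject≤ i q≤n

      module _ (A R′ : Matrix Carrier (suc q-1) (suc p-1))
        (r : Vector Carrier (suc q-1)) (s : Vector Carrier (suc p-1))
        (A₀₀ : A zero zero ≈ G zero zero)
        (A₀ⱼ : ∀ j → A zero (suc j) ≈ G zero (suc (ιp (inject₁ j))))
        (Aᵢ₀ : ∀ i → A (suc i) zero ≈ G (suc (ιq (inject₁ i))) zero)
        (Aᵢⱼ : ∀ i j → A (suc i) (suc j) ≈ G (suc (ιq (inject₁ i))) (suc (ιp (inject₁ j))))
        (R′-≈ : ∀ i j → R′ i j ≈ G′ (ιq i) (ιp j))
        (r-≈ : ∀ k → r k ≈ - u (ιq k)) (s-≈ : ∀ k → s k ≈ v (ιp k))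
        (u-outside : ∀ k → suc q-1 ℕ.≤ toℕ k → u k ≈ 0#)
        (v-outside : ∀ k → suc p-1 ℕ.≤ toℕ k → v k ≈ 0#) where

        -- The row `r` sees only the first `q` entries of `-u`, but the others vanish, so the short
        -- sum equals the full product with `G′`.
        rR′ : ∀ j → sum (λ k → r k * R′ k j) ≈ - uG′ (ιp j)
        rR′ j = begin
          sum (λ k → r k * R′ k j)
            ≈⟨ sum-cong-≋ (λ k → *-cong (r-≈ k) (R′-≈ k j)) ⟩
          sum (λ k → - u (ιq k) * G′ (ιq k) (ιp j))
            ≈⟨ sum-neg (u ∘ ιq) (λ k → G′ (ιq k) (ιp j)) ⟩
          - sum (λ k → u (ιq k) * G′ (ιq k) (ιp j))
            ≈⟨ -‿cong (sum-inject≤ q≤n (λ k → u k * G′ k (ιp j)) λ k q≤k →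
                 trans (*-congʳ (u-outside k q≤k)) (zeroˡ _)) ⟨
          - uG′ (ιp j) ∎

        R′s : ∀ i → sum (λ k → R′ i k * s k) ≈ G′v (ιq i)
        R′s i = begin
          sum (λ k → R′ i k * s k)
            ≈⟨ sum-cong-≋ (λ k → *-cong (R′-≈ i k) (s-≈ k)) ⟩
          sum (λ k → G′ (ιq i) (ιp k) * v (ιp k))
            ≈⟨ sum-inject≤ p≤n (λ k → G′ (ιq i) k * v k) (λ k p≤k →
                 trans (*-congˡ (v-outside k p≤k)) (zeroʳ _)) ⟨
          G′v (ιq i) ∎

        -- The double sum is truncated one index at a time: over `p` here, over `q` inside `rR′`.
        corner : schur ≈ α + sum (λ l → sum (λ k → r k * R′ k l) * s l)
        corner = +-congˡ (begin
          - sum (λ l → uG′ l * v l)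
            ≈⟨ sum-neg uG′ v ⟨
          sum (λ l → - uG′ l * v l)
            ≈⟨ sum-inject≤ p≤n (λ l → - uG′ l * v l) (λ l p≤l →
                 trans (*-congˡ (v-outside l p≤l)) (zeroʳ _)) ⟩
          sum (λ l → - uG′ (ιp l) * v (ιp l))
            ≈⟨ sum-cong-≋ (λ l → *-cong (rR′ l) (s-≈ l)) ⟨
          sum (λ l → sum (λ k → r k * R′ k l) * s l) ∎)

        -- Taking `schur` as the inverse makes it the bottom right entry of `T A`, the entry that
        -- `corner` computes.
        A₀₀-unit : Unit (A zero zero)
        A₀₀-unit = schur ,
          trans (*-congˡ A₀₀) schur-inverseˡ ,
          trans (*-comm _ _) (trans (*-congˡ A₀₀) schur-inverseˡ)

        ≈𝟏/ρ : A ≈𝟏/ (bordered (λ _ _ → 0#) (λ _ → 0#) (λ _ → 0#) α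
          +ᴹ updateAt 1ᴹ (fromℕ q-1) (λ _ → r) *ᴹ R′ *ᴹ λ i → updateAt (1ᴹ i) (fromℕ p-1) λ _ → s i)
        ≈𝟏/ρ = A₀₀-unit , bordered-≈-τ R′ α r s
          (λ i j → trans
            (*-congʳ (+-cong (*-cong (Aᵢⱼ i j) A₀₀) (-‿cong (*-cong (A₀ⱼ j) (Aᵢ₀ i)))))
            (trans (minor _ _) (sym (R′-≈ (inject₁ i) (inject₁ j)))))
          (λ j → trans
            (-‿cong (trans (*-congʳ (A₀ⱼ j)) (trans (*-comm _ _) (row _))))
            (sym (rR′ (inject₁ j))))
          (λ i → trans
            (*-congʳ (trans (Aᵢ₀ i) (column _)))
            (trans (*-assoc _ _ _) (trans
              (*-congˡ (trans (*-comm _ _) schur-inverseˡ))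
              (trans (*-identityʳ _) (sym (R′s (inject₁ i)))))))
          corner

-- The resolvent of a matrix padded with zeros.

module PaddedResolvent {c ℓ} (F : CommutativeRing c ℓ) where
  open CommutativeRing F hiding (zero)
  open MatrixAlgebra rawRing
  open MatrixProperties F using (sum-zero; sum-inject≤)
  open LaurentSeries rawRing renaming (rawRing to laurentRing)
  open LaurentRing F using (digit⇒≈ᴸ)
  open Resolvent F
  open Algebra.Properties.Semiring.Sum semiring using (sum-cong-≋)

  module _ {n N} (n≤N : n ℕ.≤ N) (B : Matrix Carrier n n) (A : Matrix Carrier N N)
    (A-block : ∀ i j → A (inject≤ i n≤N) (inject≤ j n≤N) ≈ B i j)
    (A-outside : ∀ i j → n ℕ.≤ toℕ i ⊎ n ℕ.≤ toℕ j → A i j ≈ 0#) where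
    private
      ι : Fin n → Fin N
      ι i = inject≤ i n≤N

      1ᴹ-ι : ∀ i j → 1ᴹ (ι i) (ι j) ≡ 1ᴹ i j
      1ᴹ-ι i j rewrite toℕ-inject≤ i n≤N | toℕ-inject≤ j n≤N = ≡.refl

      ^ᴹ-block : ∀ l i j → (A ^ᴹ l) (ι i) (ι j) ≈ (B ^ᴹ l) i j
      ^ᴹ-block zero    i j = reflexive (1ᴹ-ι i j)
      ^ᴹ-block (suc l) i j = trans
        (sum-inject≤ n≤N (λ k → A (ι i) k * (A ^ᴹ l) k (ι j))
          λ k n≤k → trans (*-congʳ (A-outside (ι i) k (inj₂ n≤k))) (zeroˡ _))
        (sum-cong-≋ λ k → *-cong (A-block i k) (^ᴹ-block l k j))

      -- A path of matrix entries from inside the block to outside it must leave the block at some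
      -- step, and the entry there is zero.
      ^ᴹ-right : ∀ l i j → toℕ i ℕ.< n → n ℕ.≤ toℕ j → (A ^ᴹ l) i j ≈ 0#
      ^ᴹ-right zero i j i<n n≤j
        rewrite dec-false (toℕ i ℕ.≟ toℕ j) (ℕ.<⇒≢ (ℕ.<-≤-trans i<n n≤j)) = refl
      ^ᴹ-right (suc l) i j i<n n≤j = sum-zero _ vanish
        where
        vanish : ∀ k → A i k * (A ^ᴹ l) k j ≈ 0#
        vanish k with ℕ.<-≤-connex (toℕ k) n
        ... | inj₁ k<n = trans (*-congˡ (^ᴹ-right l k j k<n n≤j)) (zeroʳ _)
        ... | inj₂ n≤k = trans (*-congʳ (A-outside i k (inj₂ n≤k))) (zeroˡ _)

      -- Stated for positive powers, since the zeroth is the identity even outside the block; that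
      -- power alone accounts for the `z⁻¹` on the diagonal of the resolvent there.
      ^ᴹ-outside : ∀ l i j → n ℕ.≤ toℕ i ⊎ n ℕ.≤ toℕ j → (A ^ᴹ suc l) i j ≈ 0#
      ^ᴹ-outside l i j (inj₁ n≤i) = sum-zero _ λ k →
        trans (*-congʳ (A-outside i k (inj₁ n≤i))) (zeroˡ _)
      ^ᴹ-outside l i j (inj₂ n≤j) with ℕ.<-≤-connex (toℕ i) n
      ... | inj₁ i<n = ^ᴹ-right (suc l) i j i<n n≤j
      ... | inj₂ n≤i = ^ᴹ-outside l i j (inj₁ n≤i)

    neumann-block : ∀ i j → neumann A (ι i) (ι j) ≈ᴸ neumann B i j
    neumann-block i j = digit⇒≈ᴸ ≡.refl λ where
      zero    → refl
      (suc l) → ^ᴹ-block l i j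

    neumann-outside : ∀ i j → n ℕ.≤ toℕ i ⊎ n ℕ.≤ toℕ j →
      neumann A i j ≈ᴸ (if does (toℕ i ℕ.≟ toℕ j) then z⁻¹ else constant 0#)
    neumann-outside i j outside with does (toℕ i ℕ.≟ toℕ j) in i≟j
    ... | true  = digit⇒≈ᴸ ≡.refl λ where
      zero          → refl
      -- Digit 1 is the zeroth power, an identity entry; the test inside it is settled by `i≟j`.
      (suc zero)    → reflexive (≡.cong (if_then 1# else 0#) i≟j)
      (suc (suc l)) → ^ᴹ-outside l i j outside
    ... | false = digit⇒≈ᴸ ≡.refl λ where
      zero          → refl
      (suc zero)    → reflexive (≡.cong (if_then 1# else 0#) i≟j)
      (suc (suc l)) → ^ᴹ-outside l i j outside

-- The padded band matrix, one step of the expansion, and the induction.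

module ContinuedFractionStep {c ℓ₁ ℓ₂} (K : HeytingField c ℓ₁ ℓ₂) (p-1 q-1 : ℕ) where
  open HeytingField K using (Carrier; 0#; heytingCommutativeRing)
  open HeytingCommutativeRing heytingCommutativeRing using (commutativeRing)
  private module K = CommutativeRing commutativeRing
  open LaurentSeries K.rawRing renaming (rawRing to laurentRing)
  open LaurentRing commutativeRing using (laurentCommutativeRing)
  open MatrixAlgebra laurentRing
  open MatrixProperties laurentCommutativeRing using (module BlockInverse)
  open PaddedResolvent commutativeRing
  open Resolvent commutativeRing
  private module L = CommutativeRing laurentCommutativeRing
  private module CF = ContinuedFraction K p-1 q-1

  p q : ℕ
  p = suc p-1
  q = suc q-1

  Coefficients : Set c
  Coefficients = ℤ → ℤ → Carrier

  -- The coefficients of H with its first row and column deleted.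
  advance : Coefficients → Coefficients
  advance a s k = a s (ℤ.suc k)

  [1+m]-[1+n]≡m-n : ∀ m n → + suc m ℤ.- + suc n ≡ + m ℤ.- + n
  [1+m]-[1+n]≡m-n m n = ≡.trans (ℤ.[1+m]⊖[1+n]≡m⊖n m n) (≡.sym (ℤ.[+m]-[+n]≡m⊖n m n))

  -- `h` depends on `j - i` and `min(i, j)`. Raising both indices fixes the first and raises the
  -- second by one, which `advance` accounts for.
  h-suc : ∀ a n i j → CF.h a n (suc i) (suc j) ≡ CF.h (advance a) n i j
  h-suc a n i j rewrite [1+m]-[1+n]≡m-n j i = ≡.refl

  h-row : ∀ a n j → CF.h a n 0 (suc j) ≡ (if does (suc j ℕ.≤? q) then a (+ suc j) (+ 0) else 0#)
  h-row a n j rewrite ℕ.+-identityʳ j = ≡.refl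

  h̃ : Coefficients → ℕ → ℕ → ℕ → Carrier
  h̃ a n i j = if does (i ℕ.<? n) ∧ does (j ℕ.<? n) then CF.h a n i j else 0#

  H̃ : Coefficients → ℕ → ∀ N → Matrix Carrier N N
  H̃ a n N i j = h̃ a n (toℕ i) (toℕ j)

  h̃-inside : ∀ a {n i j} → i ℕ.< n → j ℕ.< n → h̃ a n i j ≡ CF.h a n i j
  h̃-inside a {n} {i} {j} i<n j<n
    rewrite dec-true (i ℕ.<? n) i<n | dec-true (j ℕ.<? n) j<n = ≡.refl

  h̃-outside : ∀ a n i j → n ℕ.≤ i ⊎ n ℕ.≤ j → h̃ a n i j ≡ 0#
  h̃-outside a n i j (inj₁ n≤i) rewrite dec-false (i ℕ.<? n) (ℕ.≤⇒≯ n≤i) = ≡.refl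
  h̃-outside a n i j (inj₂ n≤j) with does (i ℕ.<? n)
  ... | true rewrite dec-false (j ℕ.<? n) (ℕ.≤⇒≯ n≤j) = ≡.refl
  ... | false = ≡.refl

  h̃-suc : ∀ a n i j → h̃ a (suc n) (suc i) (suc j) ≡ h̃ (advance a) n i j
  h̃-suc a n i j = ≡.cong (if does (i ℕ.<? n) ∧ does (j ℕ.<? n) then_else 0#) (h-suc a n i j)

  -- Within the band only the cutoff of the padding remains, and it is the very test that defines
  -- `b` at `k = 0`.
  h̃-row-inside : ∀ a n j → j ℕ.< q → h̃ a (suc n) 0 (suc j) ≡ CF.b a (suc n) 0 (+ suc j)
  h̃-row-inside a n j j<q rewrite h-row a (suc n) j | dec-true (suc j ℕ.≤? q) j<q = ≡.refl

  h̃-row-outside : ∀ a n j → q ℕ.≤ j → h̃ a (suc n) 0 (suc j) ≡ 0#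
  h̃-row-outside a n j q≤j rewrite h-row a (suc n) j | dec-false (suc j ℕ.≤? q) (ℕ.≤⇒≯ q≤j)
    with does (suc j ℕ.<? suc n)
  ... | true  = ≡.refl
  ... | false = ≡.refl

  h̃-column-inside : ∀ a n i → i ℕ.< p → h̃ a (suc n) (suc i) 0 ≡ CF.b a (suc n) 0 (ℤ.- + suc i)
  -- The band test `-p ≤ -(i + 1)` computes to `i ≤ p-1`.
  h̃-column-inside a n i i<p rewrite dec-true (i ℕ.≤? p-1) (ℕ.s≤s⁻¹ i<p)
    -- In a column the undecided test is the first conjunct, so it must be split before `_∧_`
    -- reduces.
    with does (suc i ℕ.<? suc n)
  ... | true  = ≡.refl
  ... | false = ≡.refl

  h̃-column-outside : ∀ a n i → p ℕ.≤ i → h̃ a (suc n) (suc i) 0 ≡ 0#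
  h̃-column-outside a n i p≤i rewrite dec-false (i ℕ.≤? p-1) (ℕ.<⇒≱ p≤i)
    with does (suc i ℕ.<? suc n)
  ... | true  = ≡.refl
  ... | false = ≡.refl

  module _ (a : Coefficients) {n N} (n≤N : n ℕ.≤ N) where
    private
      H̃-block : ∀ i j → H̃ a n N (inject≤ i n≤N) (inject≤ j n≤N) K.≈ CF.H a n i j
      H̃-block i j rewrite toℕ-inject≤ i n≤N | toℕ-inject≤ j n≤N =
        K.reflexive (h̃-inside a (toℕ<n i) (toℕ<n j))

      H̃-outside : ∀ i j → n ℕ.≤ toℕ i ⊎ n ℕ.≤ toℕ j → H̃ a n N i j K.≈ 0#
      H̃-outside i j = K.reflexive ∘ h̃-outside a n (toℕ i) (toℕ j)

      inject≤-fromℕ< : ∀ i (i<n : toℕ i ℕ.< n) → inject≤ (fromℕ< i<n) n≤N ≡ i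
      inject≤-fromℕ< i i<n = toℕ-injective (≡.trans (toℕ-inject≤ _ n≤N) (toℕ-fromℕ< i<n))

    -- Both clauses of `Rᵢⱼ` are entries of one resolvent, that of the padded matrix:
    -- `neumann-block` covers indices below `n`, `neumann-outside` the rest.
    Rᵢⱼ-padded : ∀ {x y} (i j : Fin N) → toℕ i ≡ x → toℕ j ≡ y →
      CF.Rᵢⱼ a n x y L.≈ neumann (H̃ a n N) i j
    Rᵢⱼ-padded i j ≡.refl ≡.refl with toℕ i ℕ.<? n | toℕ j ℕ.<? n
    ... | yes i<n | yes j<n = L.trans
      (L.sym (neumann-block n≤N (CF.H a n) (H̃ a n N) H̃-block H̃-outside (fromℕ< i<n) (fromℕ< j<n)))
      (L.reflexive (≡.cong₂ (neumann (H̃ a n N)) (inject≤-fromℕ< i i<n) (inject≤-fromℕ< j j<n)))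
    ... | yes _   | no j≮n  =
      L.sym (neumann-outside n≤N (CF.H a n) (H̃ a n N) H̃-block H̃-outside i j (inj₂ (ℕ.≮⇒≥ j≮n)))
    ... | no i≮n  | _       =
      L.sym (neumann-outside n≤N (CF.H a n) (H̃ a n N) H̃-block H̃-outside i j (inj₁ (ℕ.≮⇒≥ i≮n)))

  module _ (a : Coefficients) (n : ℕ) where
    private
      -- N ≥ n, p, q: one padded matrix holds both H and the q × p corner of the resolvent.
      N : ℕ
      N = n ℕ.+ (p ℕ.+ q)

      n≤N : n ℕ.≤ N
      n≤N = ℕ.m≤m+n n (p ℕ.+ q)

      p≤N : p ℕ.≤ N
      p≤N = ℕ.≤-trans (ℕ.m≤m+n p q) (ℕ.m≤n+m (p ℕ.+ q) n)

      q≤N : q ℕ.≤ N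
      q≤N = ℕ.≤-trans (ℕ.m≤n+m q p) (ℕ.m≤n+m (p ℕ.+ q) n)

      A R′ : Matrix Laurent q p
      A  = CF.R a (suc n)
      R′ = CF.R (advance a) n

      G : Matrix Laurent (suc N) (suc N)
      G = neumann (H̃ a (suc n) (suc N))

      G′ : Matrix Laurent N N
      G′ = neumann (H̃ (advance a) n N)

      α : Laurent
      α = z +ᴸ (-ᴸ constant (a (+ 0) (+ 0)))

      u v : Vector Laurent N
      u j = constant (h̃ a (suc n) 0 (suc (toℕ j)))
      v i = constant (h̃ a (suc n) (suc (toℕ i)) 0)

      open BlockInverse
        (zI- H̃ a (suc n) (suc N)) G (zI- H̃ (advance a) n N) G′ α u v
        -- The corner of `zI- H̃` reduces to `α`; off the diagonal `z` contributes only a zero,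
        -- which `+-identityˡ` removes.
        L.refl
        (λ j → L.+-identityˡ (L.- u j))
        (λ i → L.+-identityˡ (L.- v i))
        (λ i j → L.reflexive (≡.cong (λ x → scalar z i j +ᴸ (-ᴸ constant x))
          (h̃-suc a n (toℕ i) (toℕ j))))
        (neumann-inverseʳ (H̃ a (suc n) (suc N)))
        (neumann-inverseˡ (H̃ (advance a) n N))
        using (module PseudoQuotient)

      A-padded : ∀ (i : Fin q) (j : Fin p) i′ j′ →
        toℕ i′ ≡ toℕ i → toℕ j′ ≡ toℕ j → A i j L.≈ G i′ j′
      A-padded i j i′ j′ = Rᵢⱼ-padded a (ℕ.s≤s n≤N) i′ j′

      ιp : Fin p → Fin N
      ιp j = inject≤ j p≤N

      ιq : Fin q → Fin N
      ιq i = inject≤ i q≤N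

      R′-padded : ∀ i j → R′ i j L.≈ G′ (ιq i) (ιp j)
      R′-padded i j = Rᵢⱼ-padded (advance a) n≤N (ιq i) (ιp j)
        (toℕ-inject≤ i q≤N) (toℕ-inject≤ j p≤N)

      r : Vector Laurent q
      r j = -ᴸ constant (CF.b a (suc n) 0 (+ suc (toℕ j)))

      s : Vector Laurent p
      s i = constant (CF.b a (suc n) 0 (ℤ.- + suc (toℕ i)))

      constant-≡ : ∀ {x y} → x ≡ y → constant x L.≈ constant y
      constant-≡ ≡.refl = L.refl

      r-padded : ∀ k → r k L.≈ L.- u (ιq k)
      r-padded k = L.-‿cong (constant-≡ (≡.sym (≡.trans
        (≡.cong (λ x → h̃ a (suc n) 0 (suc x)) (toℕ-inject≤ k q≤N))
        (h̃-row-inside a n (toℕ k) (toℕ<n k)))))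

      s-padded : ∀ k → s k L.≈ v (ιp k)
      s-padded k = constant-≡ (≡.sym (≡.trans
        (≡.cong (λ x → h̃ a (suc n) (suc x) 0) (toℕ-inject≤ k p≤N))
        (h̃-column-inside a n (toℕ k) (toℕ<n k))))

      u-outside : ∀ k → q ℕ.≤ toℕ k → u k L.≈ L.0#
      u-outside k q≤k = constant-≡ (h̃-row-outside a n (toℕ k) q≤k)

      v-outside : ∀ k → p ℕ.≤ toℕ k → v k L.≈ L.0#
      v-outside k p≤k = constant-≡ (h̃-column-outside a n (toℕ k) p≤k)

      lowered : ∀ {l} (l≤N : suc l ℕ.≤ N) (i : Fin l) →
        suc (toℕ (inject≤ (inject₁ i) l≤N)) ≡ suc (toℕ i)
      lowered l≤N i = ≡.cong ℕ.suc (≡.trans (toℕ-inject≤ (inject₁ i) l≤N) (toℕ-inject₁ i))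

      Aᵢⱼ : ∀ i j → A (suc i) (suc j) L.≈ G (suc (ιq (inject₁ i))) (suc (ιp (inject₁ j)))
      Aᵢⱼ i j = A-padded (suc i) (suc j) (suc (ιq (inject₁ i))) (suc (ιp (inject₁ j)))
        (lowered q≤N i) (lowered p≤N j)

      A₀ⱼ : ∀ j → A zero (suc j) L.≈ G zero (suc (ιp (inject₁ j)))
      A₀ⱼ j = A-padded zero (suc j) zero (suc (ιp (inject₁ j))) ≡.refl (lowered p≤N j)

      Aᵢ₀ : ∀ i → A (suc i) zero L.≈ G (suc (ιq (inject₁ i))) zero
      Aᵢ₀ i = A-padded (suc i) zero (suc (ιq (inject₁ i))) zero (lowered q≤N i) ≡.refl

    -- The matrices of sizes `n + 1` and `n` sit in padded ones of sizes `N + 1` and `N`, so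
    -- deleting the first row and column respects the padding.
    R-≈τ : CF._≈τ[_]_ a (suc n) (CF.R a (suc n)) 0 (CF.R (advance a) n)
    R-≈τ = PseudoQuotient.≈𝟏/ρ p≤N q≤N A R′ r s
      (A-padded zero zero zero zero ≡.refl ≡.refl) A₀ⱼ Aᵢ₀ Aᵢⱼ
      R′-padded r-padded s-padded u-outside v-outside

  -- Level `k` of the shifted sequences at size `n` is definitionally level `k + 1` of the original
  -- ones at size `n + 1`: the index moves by one, and the cutoff `k + |s| < n` in `b` gains one on
  -- both sides. The witnesses pass through unchanged.
  advance-≈τ : ∀ a n k m {Y X} → CF._≈τ[_⋯+_]_ (advance a) n Y k m X →
    CF._≈τ[_⋯+_]_ a (suc n) Y (suc k) m X
  advance-≈τ a n k zero    Y≈X               = Y≈X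
  advance-≈τ a n k (suc m) (Z , Y≈τZ , Z≈τX) = Z , Y≈τZ , advance-≈τ a n (suc k) m Z≈τX

  -- Induction on `n` for all `a` at once, since each step replaces `a` by `advance a`.
  R-≈τ⋯ : ∀ a n → CF._≈τ[_⋯+_]_ a n (CF.R a n) 0 n (CF.X a n)
  -- At size zero every index lies outside the matrix, so `R` already is `X`.
  R-≈τ⋯ a zero    = lift λ i j → L.refl
  R-≈τ⋯ a (suc n) = CF.R (advance a) n , R-≈τ a n , advance-≈τ a n 0 n (R-≈τ⋯ (advance a) n)

proposition7p3 : ∀ {c ℓ₁ ℓ₂} (K : HeytingField c ℓ₁ ℓ₂) (p-1 q-1 : ℕ)
    (a : ℤ → ℤ → HeytingField.Carrier K) (n : ℕ) .{{_ : NonZero n}} →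
    let open ContinuedFraction K p-1 q-1 a n in
    R ≈τ[ 0 ⋯+ n ] X
proposition7p3 K p-1 q-1 a n = ContinuedFractionStep.R-≈τ⋯ K p-1 q-1 a n
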